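{- For every integer $k\geq 0$, the number of uniquely sorted permutations in $S_{2k+1}$ is exactly $A_{k+1}$, where $(A_m)_{m\ge 1}$ is Lassalle's sequence.
   Context: Lassalle's sequence $(A_m)_{m\geq 1}$ is defined by $A_1=1$ and $$A_m=(-1)^{m-1}C_m+\sum_{j=1}^{m-1}(-1)^{j-1}\binom{2m-1}{2m-2j-1}A_{m-j}C_j,$$ where $C_n=\frac{1}{n+1}\binom{2n}{n}$ is the $n$-th Catalan number. $S_n$ is the set of permutations of $\{1,\ldots,n\}$, written as words $\pi=\pi_1\cdots\pi_n$. The (West) stack-sorting map $s:S_n\to S_n$ is defined by the following procedure on an input $\pi=\pi_1\cdots\pi_n$, using an initially empty vertical stack. At any point in time, if there is a next entry of the input and either it is smaller than the entry at the top of the stack or the stack is empty, then that next entry is placed on top of the stack. Otherwise, the entry at the top of the stack is removed and appended to the end of the output. The procedure terminates when the output has length $n$, and $s(\pi)$ is this output. The fertility of $\pi\in S_n$ is $|s^{ -1}(\pi)|$. A permutation is uniquely sorted if its fertility is $1$. -}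

module Defs where

open import Data.Bool.Base using (if_then_else_; true; false)
open import Data.Integer.Base as ℤ using (ℤ; +_; 0ℤ; -1ℤ)
open import Data.List.Base using (List; []; _∷_; _++_; length; map; foldr; upTo)
open import Data.List.Membership.Propositional using (_∈_)
open import Data.List.Properties using (map-cong; ++-identityʳ)
open import Data.List.Relation.Binary.Permutation.Propositional
  using (_↭_; ↭-refl; ↭-sym; ↭-trans; prep)
open import Data.List.Relation.Binary.Permutation.Propositional.Properties using (shift)
open import Data.List.Relation.Unary.Unique.Propositional using (Unique)
open import Data.Nat.Base using (ℕ; zero; suc; _+_; _*_; _∸_; _/_; _<_; s≤s)
open import Data.Nat.Combinatorics using (_C_)
open import Data.Nat.Induction using (<-wellFounded; <-Rec; <-rec)
open import Data.Nat.Properties using (_<?_; m∸n≤m)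
open import Data.Product.Base using (_×_; ∃)
open import Function.Bundles using (_⇔_)
open import Induction.WellFounded using (module FixPoint)
open import Relation.Binary.PropositionalEquality using (_≡_; refl; cong; subst)
open import Relation.Nullary.Decidable.Core using (does)
open import Relation.Unary using (Pred)

-- A predicate has cardinality N when some duplicate-free list of length N
-- consists of exactly the elements satisfying it.
HasCardinality : ∀ {a ℓ} {A : Set a} → Pred A ℓ → ℕ → Set _
HasCardinality P N =
  ∃ λ xs → Unique xs × (∀ x → x ∈ xs ⇔ P x) × length xs ≡ N

-- Permutations are words over {1, …, n} in one-line notation.
Word : Set
Word = List ℕ

infix 4 _∈S_

_∈S_ : Word → ℕ → Set
π ∈S n = π ↭ map suc (upTo n)

-- sortWith input stack is what the procedure still appends to the output from
-- the state (input, stack); the head of the stack is its top.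
sortWith : List ℕ → List ℕ → List ℕ
sortWith []       []       = []
sortWith []       (t ∷ st) = t ∷ sortWith [] st
sortWith (x ∷ xs) []       = sortWith xs (x ∷ [])
sortWith (x ∷ xs) (t ∷ st) =
  if does (x <? t)
  then sortWith xs (x ∷ t ∷ st)
  else t ∷ sortWith (x ∷ xs) st

s : Word → Word
s π = sortWith π []

sortWith-↭ : ∀ xs st → sortWith xs st ↭ xs ++ st
sortWith-↭ []       []       = ↭-refl
sortWith-↭ []       (t ∷ st) = prep t (sortWith-↭ [] st)
sortWith-↭ (x ∷ xs) []       = ↭-trans (sortWith-↭ xs (x ∷ [])) (shift x xs [])
sortWith-↭ (x ∷ xs) (t ∷ st) =
  if-↭ (does (x <? t))
    (↭-trans (sortWith-↭ xs (x ∷ t ∷ st)) (shift x xs (t ∷ st)))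
    (↭-trans (prep t (sortWith-↭ (x ∷ xs) st)) (↭-sym (shift t (x ∷ xs) st)))
  where
  if-↭ : ∀ b {xs ys zs : List ℕ} → xs ↭ zs → ys ↭ zs →
         (if b then xs else ys) ↭ zs
  if-↭ true  p _ = p
  if-↭ false _ q = q

s-∈S : ∀ {n π} → π ∈S n → s π ∈S n
s-∈S {π = π} π∈S =
  ↭-trans (subst (s π ↭_) (++-identityʳ π) (sortWith-↭ π [])) π∈S

HasFertility : ℕ → Word → ℕ → Set
HasFertility n π f = HasCardinality (λ σ → σ ∈S n × s σ ≡ π) f

UniquelySorted : ℕ → Pred Word _
UniquelySorted n π = π ∈S n × HasFertility n π 1

-- The division is exact.
catalan : ℕ → ℕ
catalan n = ((2 * n) C n) / suc n

-- Σ[1≤j≤ n ] f is f 1 + ⋯ + f n.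
Σ[1≤j≤_] : ℕ → (ℕ → ℤ) → ℤ
Σ[1≤j≤ n ] f = foldr ℤ._+_ 0ℤ (map (λ i → f (suc i)) (upTo n))

-- The term of the recurrence for A m with index j, where a stands for A (m ∸ j).
lassalleTerm : ℕ → ℕ → ℤ → ℤ
lassalleTerm m j a =
  -1ℤ ℤ.^ (j ∸ 1) ℤ.* + ((2 * m ∸ 1) C (2 * m ∸ 2 * j ∸ 1)) ℤ.* a ℤ.* + catalan j

-- Here m = suc n and j = suc i, so m ∸ j = n ∸ i.
lassalleStep : ∀ m → <-Rec (λ _ → ℤ) m → ℤ
lassalleStep zero    _   = 0ℤ
lassalleStep (suc n) rec =
  -1ℤ ℤ.^ n ℤ.* + catalan (suc n) ℤ.+
  foldr ℤ._+_ 0ℤ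
    (map (λ i → lassalleTerm (suc n) (suc i) (rec {n ∸ i} (s≤s (m∸n≤m n i)))) (upTo n))

-- The sequence starts at index 1; the value at 0 is never used.
-- lassalle-1 and lassalle-rec are its defining equations.
lassalle : ℕ → ℤ
lassalle = <-rec (λ _ → ℤ) lassalleStep

private
  lassalleStep-ext : ∀ m {f g : <-Rec (λ _ → ℤ) m} →
                     (∀ {y} (y<m : y < m) → f y<m ≡ g y<m) →
                     lassalleStep m f ≡ lassalleStep m g
  lassalleStep-ext zero    _  = refl
  lassalleStep-ext (suc n) eq =
    cong (λ l → -1ℤ ℤ.^ n ℤ.* + catalan (suc n) ℤ.+ foldr ℤ._+_ 0ℤ l)
      (map-cong (λ i → cong (lassalleTerm (suc n) (suc i)) (eq (s≤s (m∸n≤m n i)))) (upTo n))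

lassalle-1 : lassalle 1 ≡ + 1
lassalle-1 = refl

lassalle-rec : ∀ n → let m = suc n in
  lassalle m ≡
    -1ℤ ℤ.^ (m ∸ 1) ℤ.* + catalan m ℤ.+
    Σ[1≤j≤ m ∸ 1 ] (λ j →
      -1ℤ ℤ.^ (j ∸ 1) ℤ.* + ((2 * m ∸ 1) C (2 * m ∸ 2 * j ∸ 1))
        ℤ.* lassalle (m ∸ j) ℤ.* + catalan j)
lassalle-rec n =
  FixPoint.unfold-wfRec <-wellFounded (λ _ → ℤ) lassalleStep lassalleStep-ext {suc n}

-- A word without repetitions is the inorder word of a decreasing binary tree, and stack-sorting it yields the
-- postorder word of that tree. Two moves preserve the postorder word: an only child may change sides, and if the
-- root of the left subtree of an inner node is smaller than the first leaf of its right subtree, then the left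
-- subtree may be hung below that leaf. Hence a uniquely sorted word is the postorder word of a "valid" tree: a full
-- decreasing tree in which the root of every left subtree exceeds the first leaf of its sibling. Conversely, the
-- valid trees are those whose postorder words have the greatest possible number of descents, so the postorder word
-- of a valid tree comes from valid trees only; and in it the leaves are the first letter and the descent bottoms,
-- so it determines the tree.
--
-- For the count, let W be the generating function of valid trees, and let Y F be that of valid trees with an
-- F-structure hung below the first leaf. Deleting the root gives (Y F)′ = F + W · Y F - Y (Y F) and W = Y 1, where
-- Y (Y F) counts the pairs of subtrees that violate validity. Let β = Σ (-1)ʲ Cⱼ x²ʲ / (2j)! and Y₀ = Σ (-1)ʲ Cⱼ J²ʲ⁺¹
-- with J the integration operator. The recurrence of the Catalan numbers says (Y₀ F)′ = F - Y₀ (Y₀ F), and by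
-- induction on the order it follows that β · Y F = Y₀ (β · F). For F = 1 this is β · W = Y₀ β = - β′, which is
-- Lassalle's recurrence.

module Submission where


open import Defs
open import Data.Bool.Base using (if_then_else_; true; false)
open import Data.Empty using (⊥)
open import Data.List.Base
  using (List; []; _∷_; _++_; length; foldr; map; concatMap; filter; cartesianProduct; applyUpTo; upTo; downFrom)
open import Data.List.Membership.Propositional using (_∈_; find; lose)
open import Data.List.Membership.Propositional.Properties
  using (∈-map⁻; ∈-map⁺; ∈-++⁻; ∈-++⁺ˡ; ∈-++⁺ʳ; ∈-∃++; ∈-concatMap⁻; ∈-concatMap⁺; ∈-filter⁻; ∈-filter⁺;
         ∈-cartesianProduct⁻; ∈-cartesianProduct⁺)
open import Data.List.Properties
  using (++-assoc; ++-cancelˡ; ++-cancelʳ; ∷-injectiveˡ; ∷-injectiveʳ; length-++; length-map; length-downFrom;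
         map-upTo; reverse-downFrom)
open import Data.List.Relation.Binary.Permutation.Propositional
  using (_↭_; ↭-refl; ↭-sym; ↭-trans; ↭-reflexive; prep; ↭⇒↭ₛ)
open import Data.List.Relation.Binary.Permutation.Propositional.Properties
  using (drop-∷; map⁺; ++⁺; shift; ++-comm; All-resp-↭; ∈-resp-↭; ↭-reverse; ↭-singleton-inv; ↭-empty-inv)
import Data.List.Relation.Binary.Permutation.Setoid.Properties as Permutationₛ
open import Data.List.Relation.Ternary.Interleaving.Propositional
  using (Interleaving; []; consˡ; consʳ; toPermutation)
open import Data.List.Relation.Unary.All as All using (All; []; _∷_)
import Data.List.Relation.Unary.All.Properties as All
open import Data.List.Relation.Unary.AllPairs as AllPairs using (AllPairs; []; _∷_)
import Data.List.Relation.Unary.AllPairs.Properties as AllPairs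
open import Data.List.Relation.Unary.Any using (here; there)
open import Data.List.Relation.Unary.Unique.Propositional using (Unique)
import Data.List.Relation.Unary.Unique.Propositional.Properties as Unique
open import Data.Nat.Base as ℕ using (ℕ; zero; suc; z≤n; s≤s; _≤_; _<_; _>_; _∸_)
import Data.Nat.Properties as ℕₚ
import Data.Nat.Tactic.RingSolver as ℕ-Solver
open import Data.Product.Base using (∃; _×_; _,_; proj₁; proj₂)
open import Data.Sum.Base using (_⊎_; inj₁; inj₂)
open import Function.Base using (_∘_)
open import Function.Bundles using (mk⇔; Equivalence)
open import Level using (Level)
open import Relation.Binary.Definitions using (tri<; tri≈; tri>)
open import Relation.Binary.PropositionalEquality
  using (_≡_; _≢_; _≗_; refl; sym; trans; cong; cong₂; subst; module ≡-Reasoning)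
open import Relation.Binary.PropositionalEquality.Properties using (setoid)
open import Relation.Nullary.Decidable using (Dec; does; yes; no; dec-true; dec-false)
open import Relation.Nullary.Negation using (¬_; contradiction)
open import Relation.Unary using (Decidable)

private variable
  ℓ : Level
  S T : Set ℓ

module _ where

  open import Data.Integer.Base using (ℤ; +_; 0ℤ; 1ℤ; -1ℤ; _+_; _*_; -_; _-_; _^_)
  import Data.Integer.Properties as ℤₚ
  open import Data.Integer.Tactic.RingSolver using (solve-∀)
  open import Data.List.Relation.Unary.All using (all?)
  open import Data.Nat.Combinatorics
    using (nCk≡nC[n∸k]; nCk+nC[k+1]≡[n+1]C[k+1]; k>n⇒nCk≡0) renaming (_C_ to _choose_)
  import Data.Nat.DivMod as ℕ
  open ≡-Reasoning

  +-congˡ : ∀ x {y z} → y ≡ z → x + y ≡ x + z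
  +-congˡ x = cong (λ y → x + y)

  -- Cauchy products of integer sequences

  Seq : Set
  Seq = ℕ → ℤ

  -- Differentiation of exponential generating functions; for ordinary ones, removal of the constant
  -- term followed by division by z.
  ∂ : Seq → Seq
  ∂ a n = a (suc n)

  -- The Euler operator z d/dz on ordinary generating functions.
  θ : Seq → Seq
  θ a n = + n * a n

  infixl 7 _⊛_

  _⊛_ : Seq → Seq → Seq
  (a ⊛ b) zero    = a 0 * b 0
  (a ⊛ b) (suc n) = a 0 * b (suc n) + (∂ a ⊛ b) n

  ⊛-cong : ∀ {a a′ b b′} → a ≗ a′ → b ≗ b′ → a ⊛ b ≗ a′ ⊛ b′
  ⊛-cong p q zero    = cong₂ _*_ (p 0) (q 0)
  ⊛-cong p q (suc n) = cong₂ _+_ (cong₂ _*_ (p 0) (q (suc n))) (⊛-cong (p ∘ suc) q n)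

  -- Mirror image of the recursion that defines `⊛`; commutativity passes from one form to the
  -- other.
  ⊛-∂ʳ : ∀ a b n → (a ⊛ b) (suc n) ≡ a (suc n) * b 0 + (a ⊛ ∂ b) n
  ⊛-∂ʳ a b zero    = ℤₚ.+-comm (a 0 * b 1) (a 1 * b 0)
  ⊛-∂ʳ a b (suc n) = begin
    a 0 * b (2 ℕ.+ n) + (∂ a ⊛ b) (suc n)
      ≡⟨ +-congˡ (a 0 * b (2 ℕ.+ n)) (⊛-∂ʳ (∂ a) b n) ⟩
    a 0 * b (2 ℕ.+ n) + (a (2 ℕ.+ n) * b 0 + (∂ a ⊛ ∂ b) n)
      ≡⟨ swap (a 0 * b (2 ℕ.+ n)) (a (2 ℕ.+ n) * b 0) ((∂ a ⊛ ∂ b) n) ⟩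
    a (2 ℕ.+ n) * b 0 + (a 0 * b (2 ℕ.+ n) + (∂ a ⊛ ∂ b) n) ∎
    where
    swap : ∀ x y z → x + (y + z) ≡ y + (x + z)
    swap = solve-∀

  ⊛-comm : ∀ a b → a ⊛ b ≗ b ⊛ a
  ⊛-comm a b zero    = ℤₚ.*-comm (a 0) (b 0)
  ⊛-comm a b (suc n) = begin
    a 0 * b (suc n) + (∂ a ⊛ b) n  ≡⟨ cong₂ _+_ (ℤₚ.*-comm (a 0) _) (⊛-comm (∂ a) b n) ⟩
    b (suc n) * a 0 + (b ⊛ ∂ a) n  ≡⟨ ⊛-∂ʳ b a n ⟨
    (b ⊛ a) (suc n)                ∎

  ⊛-linearˡ : ∀ x y a a′ b n →
              ((λ i → x * a i + y * a′ i) ⊛ b) n ≡ x * (a ⊛ b) n + y * (a′ ⊛ b) n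
  ⊛-linearˡ x y a a′ b zero    = lemma x y (a 0) (a′ 0) (b 0)
    where
    lemma : ∀ x y s t u → (x * s + y * t) * u ≡ x * (s * u) + y * (t * u)
    lemma = solve-∀
  ⊛-linearˡ x y a a′ b (suc n) = begin
    (x * a 0 + y * a′ 0) * b (suc n) + ((λ i → x * ∂ a i + y * ∂ a′ i) ⊛ b) n
      ≡⟨ +-congˡ ((x * a 0 + y * a′ 0) * b (suc n)) (⊛-linearˡ x y (∂ a) (∂ a′) b n) ⟩
    (x * a 0 + y * a′ 0) * b (suc n) + (x * (∂ a ⊛ b) n + y * (∂ a′ ⊛ b) n)
      ≡⟨ lemma x y (a 0) (a′ 0) (b (suc n)) ((∂ a ⊛ b) n) ((∂ a′ ⊛ b) n) ⟩
    x * (a ⊛ b) (suc n) + y * (a′ ⊛ b) (suc n) ∎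
    where
    lemma : ∀ x y s t u v w → (x * s + y * t) * u + (x * v + y * w) ≡ x * (s * u + v) + y * (t * u + w)
    lemma = solve-∀

  -- `θ` is a derivation because the indices of the two factors add up to `n` in every term.
  ⊛-leibniz : ∀ a b n → (θ a ⊛ b) n + (a ⊛ θ b) n ≡ + n * (a ⊛ b) n
  ⊛-leibniz a b zero    = lemma (a 0) (b 0)
    where
    lemma : ∀ x y → 0ℤ * x * y + x * (0ℤ * y) ≡ 0ℤ * (x * y)
    lemma = solve-∀
  ⊛-leibniz a b (suc n) = begin
    0ℤ * a 0 * b (suc n) + (∂ (θ a) ⊛ b) n + (a 0 * (+ suc n * b (suc n)) + (∂ a ⊛ θ b) n)
      ≡⟨ cong (λ z → 0ℤ * a 0 * b (suc n) + z + (a 0 * (+ suc n * b (suc n)) + (∂ a ⊛ θ b) n)) ∂θ ⟩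
    0ℤ * a 0 * b (suc n) + (1ℤ * (θ (∂ a) ⊛ b) n + 1ℤ * (∂ a ⊛ b) n) + (a 0 * (+ suc n * b (suc n)) + (∂ a ⊛ θ b) n)
      ≡⟨ regroup (a 0) (b (suc n)) (+ suc n) ((θ (∂ a) ⊛ b) n) ((∂ a ⊛ b) n) ((∂ a ⊛ θ b) n) ⟩
    ((θ (∂ a) ⊛ b) n + (∂ a ⊛ θ b) n) + ((∂ a ⊛ b) n + + suc n * (a 0 * b (suc n)))
      ≡⟨ cong (_+ ((∂ a ⊛ b) n + + suc n * (a 0 * b (suc n)))) (⊛-leibniz (∂ a) b n) ⟩
    + n * (∂ a ⊛ b) n + ((∂ a ⊛ b) n + (1ℤ + + n) * (a 0 * b (suc n)))
      ≡⟨ collect (+ n) ((∂ a ⊛ b) n) (a 0 * b (suc n)) ⟩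
    (1ℤ + + n) * (a 0 * b (suc n) + (∂ a ⊛ b) n) ∎
    where
    ∂θ : (∂ (θ a) ⊛ b) n ≡ 1ℤ * (θ (∂ a) ⊛ b) n + 1ℤ * (∂ a ⊛ b) n
    ∂θ = trans (⊛-cong (λ i → lemma (+ i) (∂ a i)) (λ _ → refl) n) (⊛-linearˡ 1ℤ 1ℤ (θ (∂ a)) (∂ a) b n)
      where
      lemma : ∀ i x → (1ℤ + i) * x ≡ 1ℤ * (i * x) + 1ℤ * x
      lemma = solve-∀
    regroup : ∀ a b m u v w → 0ℤ * a * b + (1ℤ * u + 1ℤ * v) + (a * (m * b) + w) ≡ (u + w) + (v + m * (a * b))
    regroup = solve-∀
    collect : ∀ m u v → m * u + (u + (1ℤ + m) * v) ≡ (1ℤ + m) * (v + u)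
    collect = solve-∀

  -- The recurrence of the Catalan numbers

  signedCatalan : Seq
  signedCatalan n = -1ℤ ^ n * + catalan n

  -- Absorption rule for binomial coefficients; the term with `k` stands on the left to avoid the
  -- truncated subtraction n - k.
  [k+1]*nC[k+1] : ∀ n k → suc k ℕ.* (n choose suc k) ℕ.+ k ℕ.* (n choose k) ≡ n ℕ.* (n choose k)
  [k+1]*nC[k+1] zero    zero    = refl
  [k+1]*nC[k+1] zero    (suc k) = cong₂ ℕ._+_ (ℕₚ.*-zeroʳ k) (ℕₚ.*-zeroʳ k)
  [k+1]*nC[k+1] (suc n) zero    = begin
    1 ℕ.* (suc n choose 1) ℕ.+ 0     ≡⟨ cong (λ z → 1 ℕ.* z ℕ.+ 0) (nCk+nC[k+1]≡[n+1]C[k+1] n 0) ⟨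
    1 ℕ.* (n choose 0 ℕ.+ n choose 1) ℕ.+ 0 ≡⟨ lemma (n choose 0) (n choose 1) ⟩
    n choose 0 ℕ.+ (1 ℕ.* (n choose 1) ℕ.+ 0) ≡⟨ cong (n choose 0 ℕ.+_) ([k+1]*nC[k+1] n 0) ⟩
    suc n ℕ.* (n choose 0)  ≡⟨⟩
    suc n ℕ.* (suc n choose 0) ∎
    where
    lemma : ∀ x y → 1 ℕ.* (x ℕ.+ y) ℕ.+ 0 ≡ x ℕ.+ (1 ℕ.* y ℕ.+ 0)
    lemma = ℕ-Solver.solve-∀
  [k+1]*nC[k+1] (suc n) (suc k) = begin
    (2 ℕ.+ k) ℕ.* (suc n choose (2 ℕ.+ k)) ℕ.+ suc k ℕ.* (suc n choose suc k)
      ≡⟨ cong₂ (λ u v → (2 ℕ.+ k) ℕ.* u ℕ.+ suc k ℕ.* v)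
           (nCk+nC[k+1]≡[n+1]C[k+1] n (suc k)) (nCk+nC[k+1]≡[n+1]C[k+1] n k) ⟨
    (2 ℕ.+ k) ℕ.* (y ℕ.+ z) ℕ.+ suc k ℕ.* (x ℕ.+ y)
      ≡⟨ lemma k x y z ⟩
    ((2 ℕ.+ k) ℕ.* z ℕ.+ suc k ℕ.* y) ℕ.+ (suc k ℕ.* y ℕ.+ k ℕ.* x) ℕ.+ (x ℕ.+ y)
      ≡⟨ cong₂ (λ u v → u ℕ.+ v ℕ.+ (x ℕ.+ y)) ([k+1]*nC[k+1] n (suc k)) ([k+1]*nC[k+1] n k) ⟩
    n ℕ.* y ℕ.+ n ℕ.* x ℕ.+ (x ℕ.+ y)
      ≡⟨ lemma′ n x y ⟩
    suc n ℕ.* (x ℕ.+ y)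
      ≡⟨ cong (suc n ℕ.*_) (nCk+nC[k+1]≡[n+1]C[k+1] n k) ⟩
    suc n ℕ.* (suc n choose suc k) ∎
    where
    x = n choose k
    y = n choose suc k
    z = n choose (2 ℕ.+ k)
    lemma : ∀ k x y z → (2 ℕ.+ k) ℕ.* (y ℕ.+ z) ℕ.+ suc k ℕ.* (x ℕ.+ y) ≡
            ((2 ℕ.+ k) ℕ.* z ℕ.+ suc k ℕ.* y) ℕ.+ (suc k ℕ.* y ℕ.+ k ℕ.* x) ℕ.+ (x ℕ.+ y)
    lemma = ℕ-Solver.solve-∀
    lemma′ : ∀ n x y → n ℕ.* y ℕ.+ n ℕ.* x ℕ.+ (x ℕ.+ y) ≡ suc n ℕ.* (x ℕ.+ y)
    lemma′ = ℕ-Solver.solve-∀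

  [n+1]*2nC[n+1] : ∀ n → suc n ℕ.* ((2 ℕ.* n) choose suc n) ≡ n ℕ.* ((2 ℕ.* n) choose n)
  [n+1]*2nC[n+1] n = ℕₚ.+-cancelʳ-≡ (n ℕ.* x) _ _ (trans ([k+1]*nC[k+1] (2 ℕ.* n) n) (lemma n x))
    where
    x = (2 ℕ.* n) choose n
    lemma : ∀ n x → 2 ℕ.* n ℕ.* x ≡ n ℕ.* x ℕ.+ n ℕ.* x
    lemma = ℕ-Solver.solve-∀

  -- The Catalan number is the difference of two adjacent binomial coefficients,
  -- which makes the division exact.
  [n+1]*catalan : ∀ n → suc n ℕ.* catalan n ≡ (2 ℕ.* n) choose n
  [n+1]*catalan n = begin
    suc n ℕ.* catalan n                          ≡⟨ cong (λ z → suc n ℕ.* (z ℕ./ suc n)) multiple ⟩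
    suc n ℕ.* ((x ℕ.∸ y) ℕ.* suc n ℕ./ suc n)   ≡⟨ cong (suc n ℕ.*_) (ℕ.m*n/n≡m (x ℕ.∸ y) (suc n)) ⟩
    suc n ℕ.* (x ℕ.∸ y)                           ≡⟨ ℕₚ.*-comm (suc n) (x ℕ.∸ y) ⟩
    (x ℕ.∸ y) ℕ.* suc n                           ≡⟨ multiple ⟨
    x                                              ∎
    where
    x = (2 ℕ.* n) choose n
    y = (2 ℕ.* n) choose suc n
    multiple : x ≡ (x ℕ.∸ y) ℕ.* suc n
    multiple = begin
      x                                    ≡⟨ ℕₚ.m+n∸n≡m x (n ℕ.* x) ⟨
      suc n ℕ.* x ℕ.∸ n ℕ.* x              ≡⟨ cong (suc n ℕ.* x ℕ.∸_) ([n+1]*2nC[n+1] n) ⟨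
      suc n ℕ.* x ℕ.∸ suc n ℕ.* y          ≡⟨ ℕₚ.*-distribˡ-∸ (suc n) x y ⟨
      suc n ℕ.* (x ℕ.∸ y)                  ≡⟨ ℕₚ.*-comm (suc n) (x ℕ.∸ y) ⟩
      (x ℕ.∸ y) ℕ.* suc n                  ∎

  2*suc : ∀ n → 2 ℕ.* suc n ≡ 2 ℕ.+ 2 ℕ.* n
  2*suc = ℕ-Solver.solve-∀

  -- Multiplication by n + 1 turns both sides into multiples of central binomial coefficients.
  -- Pascal's rule splits the one for 2n + 2 into C(2n+1, n) and C(2n+1, n+1), which are equal.
  catalan-suc : ∀ n → (2 ℕ.+ n) ℕ.* catalan (suc n) ≡ 2 ℕ.* (1 ℕ.+ 2 ℕ.* n) ℕ.* catalan n
  catalan-suc n = ℕₚ.*-cancelˡ-≡ _ _ (suc n) (begin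
    suc n ℕ.* ((2 ℕ.+ n) ℕ.* catalan (suc n))
      ≡⟨ cong (suc n ℕ.*_) ([n+1]*catalan (suc n)) ⟩
    suc n ℕ.* ((2 ℕ.* suc n) choose suc n)
      ≡⟨ cong (λ m → suc n ℕ.* (m choose suc n)) (2*suc n) ⟩
    suc n ℕ.* ((2 ℕ.+ 2 ℕ.* n) choose suc n)
      ≡⟨ cong (suc n ℕ.*_) (nCk+nC[k+1]≡[n+1]C[k+1] (1 ℕ.+ 2 ℕ.* n) n) ⟨
    suc n ℕ.* (u ℕ.+ v)
      ≡⟨ cong (λ z → suc n ℕ.* (z ℕ.+ v)) u≡v ⟩
    suc n ℕ.* (v ℕ.+ v)
      ≡⟨ double (suc n) v ⟩
    2 ℕ.* (suc n ℕ.* v)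
      ≡⟨ cong (2 ℕ.*_) [n+1]v ⟩
    2 ℕ.* ((1 ℕ.+ 2 ℕ.* n) ℕ.* ((2 ℕ.* n) choose n))
      ≡⟨ cong (λ z → 2 ℕ.* ((1 ℕ.+ 2 ℕ.* n) ℕ.* z)) ([n+1]*catalan n) ⟨
    2 ℕ.* ((1 ℕ.+ 2 ℕ.* n) ℕ.* (suc n ℕ.* catalan n))
      ≡⟨ reorder (1 ℕ.+ 2 ℕ.* n) (suc n) (catalan n) ⟩
    suc n ℕ.* (2 ℕ.* (1 ℕ.+ 2 ℕ.* n) ℕ.* catalan n) ∎)
    where
    u = (1 ℕ.+ 2 ℕ.* n) choose n
    v = (1 ℕ.+ 2 ℕ.* n) choose suc n
    double : ∀ m v → m ℕ.* (v ℕ.+ v) ≡ 2 ℕ.* (m ℕ.* v)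
    double = ℕ-Solver.solve-∀
    reorder : ∀ p q r → 2 ℕ.* (p ℕ.* (q ℕ.* r)) ≡ q ℕ.* (2 ℕ.* p ℕ.* r)
    reorder = ℕ-Solver.solve-∀
    u≡v : u ≡ v
    u≡v = sym (ℕₚ.*-cancelˡ-≡ v u (suc n) (ℕₚ.+-cancelʳ-≡ (n ℕ.* u) _ _
      (trans ([k+1]*nC[k+1] (1 ℕ.+ 2 ℕ.* n) n) (lemma n u))))
      where
      lemma : ∀ n u → (1 ℕ.+ 2 ℕ.* n) ℕ.* u ≡ suc n ℕ.* u ℕ.+ n ℕ.* u
      lemma = ℕ-Solver.solve-∀
    [n+1]v : suc n ℕ.* v ≡ (1 ℕ.+ 2 ℕ.* n) ℕ.* ((2 ℕ.* n) choose n)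
    [n+1]v = begin
      suc n ℕ.* v
        ≡⟨ cong (suc n ℕ.*_) (nCk+nC[k+1]≡[n+1]C[k+1] (2 ℕ.* n) n) ⟨
      suc n ℕ.* (x ℕ.+ (2 ℕ.* n) choose suc n)
        ≡⟨ ℕₚ.*-distribˡ-+ (suc n) x _ ⟩
      suc n ℕ.* x ℕ.+ suc n ℕ.* ((2 ℕ.* n) choose suc n)
        ≡⟨ cong (suc n ℕ.* x ℕ.+_) ([n+1]*2nC[n+1] n) ⟩
      suc n ℕ.* x ℕ.+ n ℕ.* x
        ≡⟨ lemma n x ⟩
      (1 ℕ.+ 2 ℕ.* n) ℕ.* x ∎
      where
      x = (2 ℕ.* n) choose n
      lemma : ∀ n x → suc n ℕ.* x ℕ.+ n ℕ.* x ≡ (1 ℕ.+ 2 ℕ.* n) ℕ.* x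
      lemma = ℕ-Solver.solve-∀

  signedCatalan-suc : ∀ n → (+ n + + 2) * signedCatalan (suc n) ≡ - + 2 * (1ℤ + + 2 * + n) * signedCatalan n
  signedCatalan-suc n = begin
    (+ n + + 2) * (-1ℤ * -1ℤ ^ n * + catalan (suc n))
      ≡⟨ reorder (+ n) (-1ℤ ^ n) (+ catalan (suc n)) ⟩
    - -1ℤ ^ n * ((+ 2 + + n) * + catalan (suc n))
      ≡⟨ cong (λ z → - -1ℤ ^ n * z) cast ⟩
    - -1ℤ ^ n * (+ 2 * (1ℤ + + 2 * + n) * + catalan n)
      ≡⟨ reorder′ (-1ℤ ^ n) (1ℤ + + 2 * + n) (+ catalan n) ⟩
    - + 2 * (1ℤ + + 2 * + n) * (-1ℤ ^ n * + catalan n) ∎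
    where
    reorder : ∀ m e x → (m + + 2) * (-1ℤ * e * x) ≡ - e * ((+ 2 + m) * x)
    reorder = solve-∀
    reorder′ : ∀ e y x → - e * (+ 2 * y * x) ≡ - + 2 * y * (e * x)
    reorder′ = solve-∀
    cast : (+ 2 + + n) * + catalan (suc n) ≡ + 2 * (1ℤ + + 2 * + n) * + catalan n
    cast = begin
      + (2 ℕ.+ n) * + catalan (suc n)
        ≡⟨ ℤₚ.pos-* (2 ℕ.+ n) (catalan (suc n)) ⟨
      + ((2 ℕ.+ n) ℕ.* catalan (suc n))
        ≡⟨ cong (λ z → + z) (catalan-suc n) ⟩
      + (2 ℕ.* (1 ℕ.+ 2 ℕ.* n) ℕ.* catalan n)
        ≡⟨ ℤₚ.pos-* (2 ℕ.* (1 ℕ.+ 2 ℕ.* n)) (catalan n) ⟩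
      + (2 ℕ.* (1 ℕ.+ 2 ℕ.* n)) * + catalan n
        ≡⟨ cong (_* + catalan n) (ℤₚ.pos-* 2 (1 ℕ.+ 2 ℕ.* n)) ⟩
      + 2 * + (1 ℕ.+ 2 ℕ.* n) * + catalan n
        ≡⟨ cong (λ z → + 2 * (1ℤ + z) * + catalan n) (ℤₚ.pos-* 2 n) ⟩
      + 2 * (1ℤ + + 2 * + n) * + catalan n ∎

  -- Writing c for the sequence and q for its shift, (j + 2) q j = - (4 j + 2) c j, while by the Leibniz rule
  -- and symmetry 2 (θ c ⊛ c) n = n (c ⊛ c) n; these turn a relation between (c ⊛ c) (n + 1) and (c ⊛ c) n
  -- into the same relation as that between q (n + 1) and q n.
  signedCatalan-⊛ : ∀ n → (signedCatalan ⊛ signedCatalan) n ≡ - signedCatalan (suc n)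
  signedCatalan-⊛ zero    = refl
  signedCatalan-⊛ (suc n) = ℤₚ.*-cancelˡ-≡ (+ (3 ℕ.+ n)) _ _ (begin
    (+ 3 + + n) * c² (suc n)
      ≡⟨ lemma₁ (+ n) (c² (suc n)) ⟩
    + suc n * c² (suc n) + + 2 * c² (suc n)
      ≡⟨ cong (_+ + 2 * c² (suc n)) (2θ (suc n)) ⟨
    + 2 * (θ c ⊛ c) (suc n) + + 2 * c² (suc n)
      ≡⟨⟩
    + 2 * (0ℤ * c 0 * c (suc n) + (∂ (θ c) ⊛ c) n) + + 2 * (1ℤ * c (suc n) + (∂ c ⊛ c) n)
      ≡⟨ lemma₂ (c 0) (c (suc n)) ((∂ (θ c) ⊛ c) n) ((∂ c ⊛ c) n) ⟩
    + 2 * c (suc n) + + 2 * (1ℤ * (∂ (θ c) ⊛ c) n + 1ℤ * (∂ c ⊛ c) n)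
      ≡⟨ cong (λ z → + 2 * c (suc n) + + 2 * z) ratio ⟩
    + 2 * c (suc n) + + 2 * (- + 4 * (θ c ⊛ c) n + - + 2 * c² n)
      ≡⟨ lemma₃ (c (suc n)) ((θ c ⊛ c) n) (c² n) ⟩
    + 2 * c (suc n) - + 4 * (+ 2 * (θ c ⊛ c) n + c² n)
      ≡⟨ cong (λ z → + 2 * c (suc n) - + 4 * (z + c² n)) (2θ n) ⟩
    + 2 * c (suc n) - + 4 * (+ n * c² n + c² n)
      ≡⟨ cong (λ z → + 2 * c (suc n) - + 4 * (+ n * z + z)) (signedCatalan-⊛ n) ⟩
    + 2 * c (suc n) - + 4 * (+ n * - c (suc n) + - c (suc n))
      ≡⟨ lemma₄ (+ n) (c (suc n)) ⟩
    - (- + 2 * (1ℤ + + 2 * (1ℤ + + n)) * c (suc n))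
      ≡⟨ cong -_ (signedCatalan-suc (suc n)) ⟨
    - ((1ℤ + + n + + 2) * c (2 ℕ.+ n))
      ≡⟨ lemma₅ (+ n) (c (2 ℕ.+ n)) ⟩
    (+ 3 + + n) * - c (2 ℕ.+ n) ∎)
    where
    c = signedCatalan
    c² = c ⊛ c
    2θ : ∀ m → + 2 * (θ c ⊛ c) m ≡ + m * c² m
    2θ m = begin
      + 2 * (θ c ⊛ c) m              ≡⟨ twice ((θ c ⊛ c) m) ⟩
      (θ c ⊛ c) m + (θ c ⊛ c) m      ≡⟨ +-congˡ ((θ c ⊛ c) m) (⊛-comm (θ c) c m) ⟩
      (θ c ⊛ c) m + (c ⊛ θ c) m      ≡⟨ ⊛-leibniz c c m ⟩
      + m * c² m                      ∎
      where
      twice : ∀ x → + 2 * x ≡ x + x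
      twice = solve-∀
    ratio : 1ℤ * (∂ (θ c) ⊛ c) n + 1ℤ * (∂ c ⊛ c) n ≡ - + 4 * (θ c ⊛ c) n + - + 2 * c² n
    ratio = begin
      1ℤ * (∂ (θ c) ⊛ c) n + 1ℤ * (∂ c ⊛ c) n
        ≡⟨ ⊛-linearˡ 1ℤ 1ℤ (∂ (θ c)) (∂ c) c n ⟨
      ((λ i → 1ℤ * ∂ (θ c) i + 1ℤ * ∂ c i) ⊛ c) n
        ≡⟨ ⊛-cong (λ i → trans (lemma (+ i) (c (suc i)))
             (trans (signedCatalan-suc i) (lemma′ (+ i) (c i)))) (λ _ → refl) n ⟩
      ((λ i → - + 4 * θ c i + - + 2 * c i) ⊛ c) n
        ≡⟨ ⊛-linearˡ (- + 4) (- + 2) (θ c) c c n ⟩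
      - + 4 * (θ c ⊛ c) n + - + 2 * c² n ∎
      where
      lemma : ∀ i x → 1ℤ * ((1ℤ + i) * x) + 1ℤ * x ≡ (i + + 2) * x
      lemma = solve-∀
      lemma′ : ∀ i x → - + 2 * (1ℤ + + 2 * i) * x ≡ - + 4 * (i * x) + - + 2 * x
      lemma′ = solve-∀
    lemma₁ : ∀ m x → (+ 3 + m) * x ≡ (1ℤ + m) * x + + 2 * x
    lemma₁ = solve-∀
    lemma₂ : ∀ k x u v → + 2 * (0ℤ * k * x + u) + + 2 * (1ℤ * x + v) ≡ + 2 * x + + 2 * (1ℤ * u + 1ℤ * v)
    lemma₂ = solve-∀
    lemma₃ : ∀ x u v → + 2 * x + + 2 * (- + 4 * u + - + 2 * v) ≡ + 2 * x - + 4 * (+ 2 * u + v)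
    lemma₃ = solve-∀
    lemma₄ : ∀ m x → + 2 * x - + 4 * (m * - x + - x) ≡ - (- + 2 * (1ℤ + + 2 * (1ℤ + m)) * x)
    lemma₄ = solve-∀
    lemma₅ : ∀ m x → - ((1ℤ + m + + 2) * x) ≡ (+ 3 + m) * - x
    lemma₅ = solve-∀

  -- The even power series of the signed Catalan numbers

  -- As a power series, spread a is a(z²).
  spread : Seq → Seq
  spread a zero          = a 0
  spread a (suc zero)    = 0ℤ
  spread a (suc (suc n)) = spread (∂ a) n

  spread-cong : ∀ {a b} → a ≗ b → spread a ≗ spread b
  spread-cong p zero          = p 0
  spread-cong p (suc zero)    = refl
  spread-cong p (suc (suc n)) = spread-cong (p ∘ suc) n

  spread-neg : ∀ a n → spread (λ i → - a i) n ≡ - spread a n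
  spread-neg a zero          = refl
  spread-neg a (suc zero)    = refl
  spread-neg a (suc (suc n)) = spread-neg (∂ a) n

  spread-linear : ∀ x a b n → spread (λ i → x * a i + b i) n ≡ x * spread a n + spread b n
  spread-linear x a b zero          = refl
  spread-linear x a b (suc zero)    = lemma x
    where
    lemma : ∀ x → 0ℤ ≡ x * 0ℤ + 0ℤ
    lemma = solve-∀
  spread-linear x a b (suc (suc n)) = spread-linear x (∂ a) (∂ b) n

  spread-⊛ : ∀ a b n → (spread a ⊛ spread b) n ≡ spread (a ⊛ b) n
  spread-⊛ a b zero          = refl
  spread-⊛ a b (suc zero)    = lemma (a 0) (b 0)
    where
    lemma : ∀ x y → x * 0ℤ + 0ℤ * y ≡ 0ℤ
    lemma = solve-∀
  spread-⊛ a b (suc (suc n)) = begin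
    a 0 * spread (∂ b) n + (0ℤ * spread b (suc n) + (spread (∂ a) ⊛ spread b) n)
      ≡⟨ lemma (a 0 * spread (∂ b) n) (spread b (suc n)) _ ⟩
    a 0 * spread (∂ b) n + (spread (∂ a) ⊛ spread b) n
      ≡⟨ +-congˡ (a 0 * spread (∂ b) n) (spread-⊛ (∂ a) b n) ⟩
    a 0 * spread (∂ b) n + spread (∂ a ⊛ b) n
      ≡⟨ spread-linear (a 0) (∂ b) (∂ a ⊛ b) n ⟨
    spread (∂ (a ⊛ b)) n ∎
    where
    lemma : ∀ x y z → x + (0ℤ * y + z) ≡ x + z
    lemma = solve-∀

  -- This sequence is read in three ways: as an ordinary generating function under `⊛`, as an
  -- exponential one under `⊙` and `⋄`, and as a power series in the integration operator under `✶`.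
  β : Seq
  β = spread signedCatalan

  -- The quadratic equation β² = (1 - β) / z², which comes from that of the signed Catalan numbers
  -- by substituting z² for z.
  β-⊛ : ∀ n → (β ⊛ β) n ≡ - β (2 ℕ.+ n)
  β-⊛ n = begin
    (β ⊛ β) n                                   ≡⟨ spread-⊛ signedCatalan signedCatalan n ⟩
    spread (signedCatalan ⊛ signedCatalan) n     ≡⟨ spread-cong signedCatalan-⊛ n ⟩
    spread (λ i → - signedCatalan (suc i)) n     ≡⟨ spread-neg (∂ signedCatalan) n ⟩
    - β (2 ℕ.+ n)                               ∎

  -- Lassalle's recurrence as an identity of exponential generating functions

  infixl 7 _⊙_

  -- The product of exponential generating functions, determined by its constant term and the
  -- product rule.
  _⊙_ : Seq → Seq → Seq
  (a ⊙ b) zero    = a 0 * b 0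
  (a ⊙ b) (suc n) = (∂ a ⊙ b) n + (a ⊙ ∂ b) n

  ∑ : ℕ → (ℕ → ℤ) → ℤ
  ∑ n f = foldr _+_ 0ℤ (applyUpTo f n)

  ∑-cong : ∀ n {f g : ℕ → ℤ} → (∀ {i} → i < n → f i ≡ g i) → ∑ n f ≡ ∑ n g
  ∑-cong zero    p = refl
  ∑-cong (suc n) p = cong₂ _+_ (p (s≤s z≤n)) (∑-cong n (p ∘ s≤s))

  ∑-+ : ∀ n f g → ∑ n (λ i → f i + g i) ≡ ∑ n f + ∑ n g
  ∑-+ zero    f g = refl
  ∑-+ (suc n) f g = trans (+-congˡ (f 0 + g 0) (∑-+ n (∂ f) (∂ g))) (lemma (f 0) (g 0) (∑ n (∂ f)) (∑ n (∂ g)))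
    where
    lemma : ∀ x y u v → x + y + (u + v) ≡ x + u + (y + v)
    lemma = solve-∀

  ∑-neg : ∀ n f → ∑ n (λ i → - f i) ≡ - ∑ n f
  ∑-neg zero    f = refl
  ∑-neg (suc n) f = trans (+-congˡ (- f 0) (∑-neg n (∂ f))) (sym (ℤₚ.neg-distrib-+ (f 0) (∑ n (∂ f))))

  ∑-zero : ∀ n {f : ℕ → ℤ} → (∀ {i} → i < n → f i ≡ 0ℤ) → ∑ n f ≡ 0ℤ
  ∑-zero zero    p = refl
  ∑-zero (suc n) p = cong₂ _+_ (p (s≤s z≤n)) (∑-zero n (p ∘ s≤s))

  ∑-last : ∀ n f → ∑ (suc n) f ≡ ∑ n f + f n
  ∑-last zero    f = ℤₚ.+-comm (f 0) 0ℤ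
  ∑-last (suc n) f = trans (+-congˡ (f 0) (∑-last n (∂ f))) (sym (ℤₚ.+-assoc (f 0) (∑ n (∂ f)) (f (suc n))))

  -- The product rule contributes two sums over the same range, which Pascal's rule merges termwise.
  ⊙-binomial : ∀ n a b → (a ⊙ b) n ≡ ∑ (suc n) (λ i → + (n choose i) * (a i * b (n ∸ i)))
  ⊙-binomial zero    a b = lemma (a 0 * b 0)
    where
    lemma : ∀ x → x ≡ 1ℤ * x + 0ℤ
    lemma = solve-∀
  ⊙-binomial (suc n) a b = begin
    (∂ a ⊙ b) n + (a ⊙ ∂ b) n
      ≡⟨ cong₂ _+_ (⊙-binomial n (∂ a) b) (trans (⊙-binomial n a (∂ b)) reindex) ⟩
    ∑ (suc n) f + (1ℤ * (a 0 * b (suc n)) + ∑ (suc n) g)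
      ≡⟨ lemma (∑ (suc n) f) (1ℤ * (a 0 * b (suc n))) (∑ (suc n) g) ⟩
    1ℤ * (a 0 * b (suc n)) + (∑ (suc n) f + ∑ (suc n) g)
      ≡⟨ +-congˡ (1ℤ * (a 0 * b (suc n))) (∑-+ (suc n) f g) ⟨
    1ℤ * (a 0 * b (suc n)) + ∑ (suc n) (λ i → f i + g i)
      ≡⟨ +-congˡ (1ℤ * (a 0 * b (suc n))) (∑-cong (suc n) (λ {i} _ → pascal i)) ⟩
    ∑ (2 ℕ.+ n) (λ i → + (suc n choose i) * (a i * b (suc n ∸ i))) ∎
    where
    f g : ℕ → ℤ
    f i = + (n choose i) * (a (suc i) * b (n ∸ i))
    g i = + (n choose suc i) * (a (suc i) * b (n ∸ i))
    lemma : ∀ x y z → x + (y + z) ≡ y + (x + z)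
    lemma = solve-∀
    pascal : ∀ i → f i + g i ≡ + (suc n choose suc i) * (a (suc i) * b (n ∸ i))
    pascal i = trans (sym (ℤₚ.*-distribʳ-+ (a (suc i) * b (n ∸ i)) (+ (n choose i)) (+ (n choose suc i))))
                     (cong (λ m → + m * (a (suc i) * b (n ∸ i))) (nCk+nC[k+1]≡[n+1]C[k+1] n i))
    h : ℕ → ℤ
    h i = + (n choose i) * (a i * b (suc n ∸ i))
    reindex : ∑ (suc n) (λ i → + (n choose i) * (a i * b (suc (n ∸ i)))) ≡ ∑ (2 ℕ.+ n) h
    reindex = begin
      ∑ (suc n) (λ i → + (n choose i) * (a i * b (suc (n ∸ i))))
        ≡⟨ ∑-cong (suc n) (λ {i} i<1+n →
             cong (λ m → + (n choose i) * (a i * b m)) (sym (ℕₚ.+-∸-assoc 1 (ℕₚ.≤-pred i<1+n)))) ⟩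
      ∑ (suc n) h
        ≡⟨ ℤₚ.+-identityʳ _ ⟨
      ∑ (suc n) h + 0ℤ
        -- The term added at index `suc n` vanishes with its binomial coefficient.
        ≡⟨ +-congˡ (∑ (suc n) h) (cong (λ m → + m * (a (suc n) * b (n ∸ n))) (k>n⇒nCk≡0 (ℕₚ.n<1+n n))) ⟨
      ∑ (suc n) h + h (suc n)
        ≡⟨ ∑-last (suc n) h ⟨
      ∑ (2 ℕ.+ n) h ∎

  parity : ∀ n → ∃ λ m → n ≡ 2 ℕ.* m ⊎ n ≡ suc (2 ℕ.* m)
  parity zero    = 0 , inj₁ refl
  parity (suc n) with parity n
  ... | m , inj₁ eq = m , inj₂ (cong suc eq)
  ... | m , inj₂ eq = suc m , inj₁ (trans (cong suc eq) (sym (2*suc m)))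

  spread-even : ∀ a m → spread a (2 ℕ.* m) ≡ a m
  spread-even a zero    = refl
  spread-even a (suc m) = trans (cong (spread a) (2*suc m)) (spread-even (∂ a) m)

  spread-odd : ∀ a m → spread a (suc (2 ℕ.* m)) ≡ 0ℤ
  spread-odd a zero    = refl
  spread-odd a (suc m) = trans (cong (spread a ∘ suc) (2*suc m)) (spread-odd (∂ a) m)

  ∑-even : ∀ m f → (∀ j → f (suc (2 ℕ.* j)) ≡ 0ℤ) → ∑ (2 ℕ.* m) f ≡ ∑ m (λ j → f (2 ℕ.* j))
  ∑-even zero    f p = refl
  ∑-even (suc m) f p = begin
    ∑ (2 ℕ.* suc m) f                                ≡⟨ cong (λ n → ∑ n f) (2*suc m) ⟩
    f 0 + (f 1 + ∑ (2 ℕ.* m) (∂ (∂ f)))              ≡⟨ cong (λ z → f 0 + (z + ∑ (2 ℕ.* m) (∂ (∂ f)))) (p 0) ⟩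
    f 0 + (0ℤ + ∑ (2 ℕ.* m) (∂ (∂ f)))               ≡⟨ +-congˡ (f 0) (ℤₚ.+-identityˡ _) ⟩
    f 0 + ∑ (2 ℕ.* m) (∂ (∂ f))
      ≡⟨ +-congˡ (f 0) (∑-even m (∂ (∂ f)) λ j → trans (cong (f ∘ suc) (sym (2*suc j))) (p (suc j))) ⟩
    f 0 + ∑ m (λ j → f (2 ℕ.+ 2 ℕ.* j))              ≡⟨ +-congˡ (f 0) (∑-cong m λ {j} _ → cong f (2*suc j)) ⟨
    f 0 + ∑ m (λ j → f (2 ℕ.* suc j))                ∎

  -- The sequence 0, A₁, 0, A₂, 0, ..., indexed by the number of labels.
  ω : Seq
  ω zero    = 0ℤ
  ω (suc n) = spread (∂ lassalle) n

  ω-even : ∀ m → ω (2 ℕ.* m) ≡ 0ℤ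
  ω-even zero    = refl
  ω-even (suc m) = trans (cong ω (2*suc m)) (spread-odd (∂ lassalle) m)

  ω-odd : ∀ m → ω (suc (2 ℕ.* m)) ≡ lassalle (suc m)
  ω-odd m = spread-even (∂ lassalle) m

  -- The two indices in each term have the same parity, while `β` vanishes at odd and `ω` at even
  -- indices.
  β⊙ω-even : ∀ m → (β ⊙ ω) (2 ℕ.* m) ≡ 0ℤ
  β⊙ω-even m = trans (⊙-binomial (2 ℕ.* m) β ω) (∑-zero (suc (2 ℕ.* m)) λ {i} _ → term i (parity i))
    where
    vanish : ∀ i → β i * ω (2 ℕ.* m ∸ i) ≡ 0ℤ → + (2 ℕ.* m choose i) * (β i * ω (2 ℕ.* m ∸ i)) ≡ 0ℤ
    vanish i p = trans (cong (λ z → + (2 ℕ.* m choose i) * z) p) (ℤₚ.*-zeroʳ (+ (2 ℕ.* m choose i)))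
    term : ∀ i → (∃ λ j → i ≡ 2 ℕ.* j ⊎ i ≡ suc (2 ℕ.* j)) → + (2 ℕ.* m choose i) * (β i * ω (2 ℕ.* m ∸ i)) ≡ 0ℤ
    term i (j , inj₁ refl) = vanish i (trans
      (cong (β i *_) (trans (cong ω (sym (ℕₚ.*-distribˡ-∸ 2 m j))) (ω-even (m ∸ j)))) (ℤₚ.*-zeroʳ (β i)))
    term i (j , inj₂ refl) = vanish i (trans
      (cong (_* ω (2 ℕ.* m ∸ i)) (spread-odd signedCatalan j)) (ℤₚ.*-zeroˡ (ω (2 ℕ.* m ∸ i))))

  -- By parity only even indices `i` contribute. The term for 0 is Lassalle's number itself and the
  -- others are the negated terms of its recurrence, so only the Catalan term of the recurrence
  -- remains.
  β⊙ω-odd : ∀ m → (β ⊙ ω) (suc (2 ℕ.* m)) ≡ - signedCatalan (suc m)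
  β⊙ω-odd m = begin
    (β ⊙ ω) n
      ≡⟨ ⊙-binomial n β ω ⟩
    ∑ (suc n) f
      ≡⟨ cong (λ k → ∑ k f) (2*suc m) ⟨
    ∑ (2 ℕ.* suc m) f
      ≡⟨ ∑-even (suc m) f f-odd ⟩
    f 0 + ∑ m (λ j → f (2 ℕ.* suc j))
      ≡⟨ cong₂ _+_ (trans (lemma (ω n)) (ω-odd m)) (∑-cong m f-even) ⟩
    lassalle (suc m) + ∑ m (λ j → - g j)
      ≡⟨ cong₂ _+_ (lassalle-rec m) (∑-neg m g) ⟩
    -1ℤ ^ m * + catalan (suc m) + foldr _+_ 0ℤ (map g (upTo m)) + - ∑ m g
      ≡⟨ cong (λ l → -1ℤ ^ m * + catalan (suc m) + foldr _+_ 0ℤ l + - ∑ m g) (map-upTo g m) ⟩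
    -1ℤ ^ m * + catalan (suc m) + ∑ m g + - ∑ m g
      ≡⟨ lemma′ (-1ℤ ^ m) (+ catalan (suc m)) (∑ m g) ⟩
    - signedCatalan (suc m) ∎
    where
    n = suc (2 ℕ.* m)
    f g : ℕ → ℤ
    f i = + (n choose i) * (β i * ω (n ∸ i))
    g i = lassalleTerm (suc m) (suc i) (lassalle (m ∸ i))
    lemma : ∀ x → 1ℤ * (1ℤ * x) ≡ x
    lemma = solve-∀
    lemma′ : ∀ e x y → e * x + y + - y ≡ - (-1ℤ * e * x)
    lemma′ = solve-∀
    f-odd : ∀ j → f (suc (2 ℕ.* j)) ≡ 0ℤ
    f-odd j = trans (cong (λ z → + (n choose suc (2 ℕ.* j)) * (z * ω (n ∸ suc (2 ℕ.* j)))) (spread-odd signedCatalan j))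
                    (zeros (+ (n choose suc (2 ℕ.* j))) (ω (n ∸ suc (2 ℕ.* j))))
      where
      zeros : ∀ x y → x * (0ℤ * y) ≡ 0ℤ
      zeros = solve-∀
    f-even : ∀ {j} → j < m → f (2 ℕ.* suc j) ≡ - g j
    f-even {j} j<m = begin
      + (n choose (2 ℕ.* suc j)) * (β (2 ℕ.* suc j) * ω (n ∸ 2 ℕ.* suc j))
        ≡⟨ cong₂ (λ x y → + x * (y * ω (n ∸ 2 ℕ.* suc j))) symmetry (spread-even signedCatalan (suc j)) ⟩
      + (k choose l) * (signedCatalan (suc j) * ω (n ∸ 2 ℕ.* suc j))
        ≡⟨ cong (λ z → + (k choose l) * (signedCatalan (suc j) * z)) ω≡ ⟩
      + (k choose l) * (-1ℤ * -1ℤ ^ j * + catalan (suc j) * lassalle (m ∸ j))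
        ≡⟨ reorder (+ (k choose l)) (-1ℤ ^ j) (+ catalan (suc j)) (lassalle (m ∸ j)) ⟩
      - g j ∎
      where
      k = 2 ℕ.* suc m ∸ 1
      l = 2 ℕ.* suc m ∸ 2 ℕ.* suc j ∸ 1
      reorder : ∀ p e c a → p * (-1ℤ * e * c * a) ≡ - (e * p * a * c)
      reorder = solve-∀
      n≡k : n ≡ k
      n≡k = sym (cong (_∸ 1) (2*suc m))
      2+2j≤n : 2 ℕ.* suc j ≤ n
      2+2j≤n = ℕₚ.m≤n⇒m≤1+n (ℕₚ.*-monoʳ-≤ 2 j<m)
      n∸≡ : n ∸ 2 ℕ.* suc j ≡ l
      n∸≡ = begin
        n ∸ 2 ℕ.* suc j                      ≡⟨ cong (_∸ 2 ℕ.* suc j) n≡k ⟩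
        2 ℕ.* suc m ∸ 1 ∸ 2 ℕ.* suc j        ≡⟨ ℕₚ.∸-+-assoc (2 ℕ.* suc m) 1 (2 ℕ.* suc j) ⟩
        2 ℕ.* suc m ∸ (1 ℕ.+ 2 ℕ.* suc j)    ≡⟨ cong (2 ℕ.* suc m ∸_) (ℕₚ.+-comm 1 (2 ℕ.* suc j)) ⟩
        2 ℕ.* suc m ∸ (2 ℕ.* suc j ℕ.+ 1)    ≡⟨ ℕₚ.∸-+-assoc (2 ℕ.* suc m) (2 ℕ.* suc j) 1 ⟨
        l                                    ∎
      -- Lassalle's recurrence contains the complementary binomial coefficient.
      symmetry : n choose (2 ℕ.* suc j) ≡ k choose l
      symmetry = trans (nCk≡nC[n∸k] 2+2j≤n) (cong₂ _choose_ n≡k n∸≡)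
      ω≡ : ω (n ∸ 2 ℕ.* suc j) ≡ lassalle (m ∸ j)
      ω≡ = begin
        ω (n ∸ 2 ℕ.* suc j)                ≡⟨ cong ω (ℕₚ.+-∸-assoc 1 (ℕₚ.*-monoʳ-≤ 2 j<m)) ⟩
        ω (suc (2 ℕ.* m ∸ 2 ℕ.* suc j))    ≡⟨ cong (ω ∘ suc) (ℕₚ.*-distribˡ-∸ 2 m (suc j)) ⟨
        ω (suc (2 ℕ.* (m ∸ suc j)))        ≡⟨ ω-odd (m ∸ suc j) ⟩
        lassalle (suc (m ∸ suc j))         ≡⟨ cong lassalle (ℕₚ.+-∸-assoc 1 j<m) ⟨
        lassalle (m ∸ j)                   ∎

  -- Both parities together say β · ω = - β′, the equation that the generating function of valid
  -- trees will also satisfy.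
  β⊙ω : ∀ n → (β ⊙ ω) n ≡ - β (suc n)
  β⊙ω n with parity n
  ... | m , inj₁ refl = trans (β⊙ω-even m) (sym (cong -_ (spread-odd signedCatalan m)))
  ... | m , inj₂ refl = trans (β⊙ω-odd m)
    (sym (cong -_ (trans (cong β (sym (2*suc m))) (spread-even signedCatalan (suc m)))))

  -- Sums over the ways of splitting a list

  Decreasing : List ℕ → Set
  Decreasing = AllPairs _>_

  All-interleaving : ∀ {p} {P : S → Set p} {A B X} → Interleaving A B X → All P X → All P A × All P B
  All-interleaving []          []       = [] , []
  All-interleaving (consˡ i) (p ∷ ps) with All-interleaving i ps
  ... | as , bs = p ∷ as , bs
  All-interleaving (consʳ i) (p ∷ ps) with All-interleaving i ps
  ... | as , bs = as , p ∷ bs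

  AllPairs-interleaving : ∀ {r} {R : S → S → Set r} {A B X} → Interleaving A B X →
                          AllPairs R X → AllPairs R A × AllPairs R B
  AllPairs-interleaving []          []       = [] , []
  AllPairs-interleaving (consˡ i) (p ∷ ps) with All-interleaving i p | AllPairs-interleaving i ps
  ... | q , _ | as , bs = q ∷ as , bs
  AllPairs-interleaving (consʳ i) (p ∷ ps) with All-interleaving i p | AllPairs-interleaving i ps
  ... | _ , q | as , bs = as , q ∷ bs

  length-interleaving : {A B X : List S} → Interleaving A B X → length A ≤ length X × length B ≤ length X
  length-interleaving []          = z≤n , z≤n
  length-interleaving (consˡ i) with length-interleaving i
  ... | a , b = s≤s a , ℕₚ.m≤n⇒m≤1+n b
  length-interleaving (consʳ i) with length-interleaving i
  ... | a , b = ℕₚ.m≤n⇒m≤1+n a , s≤s b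

  length-interleaving-< : ∀ {y} {A B X : List S} → Interleaving (y ∷ A) B X → length B < length X
  length-interleaving-< (consˡ i) = s≤s (proj₂ (length-interleaving i))
  length-interleaving-< (consʳ i) = s≤s (length-interleaving-< i)

  ∑ˢ : List S → (List S → List S → ℤ) → ℤ
  ∑ˢ []      h = h [] []
  ∑ˢ (x ∷ X) h = ∑ˢ X (λ A B → h (x ∷ A) B) + ∑ˢ X (λ A B → h A (x ∷ B))

  ∑ˢ-cong : ∀ (X : List S) {g h} → (∀ {A B} → Interleaving A B X → g A B ≡ h A B) → ∑ˢ X g ≡ ∑ˢ X h
  ∑ˢ-cong []      p = p []
  ∑ˢ-cong (x ∷ X) p = cong₂ _+_ (∑ˢ-cong X (p ∘ consˡ)) (∑ˢ-cong X (p ∘ consʳ))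

  ∑ˢ-+ : ∀ (X : List S) g h → ∑ˢ X (λ A B → g A B + h A B) ≡ ∑ˢ X g + ∑ˢ X h
  ∑ˢ-+ []      g h = refl
  ∑ˢ-+ (x ∷ X) g h = trans (cong₂ _+_ (∑ˢ-+ X _ _) (∑ˢ-+ X _ _)) (lemma (∑ˢ X _) (∑ˢ X _) (∑ˢ X _) (∑ˢ X _))
    where
    lemma : ∀ x y u v → x + y + (u + v) ≡ x + u + (y + v)
    lemma = solve-∀

  ∑ˢ-*ˡ : ∀ (X : List S) c h → ∑ˢ X (λ A B → c * h A B) ≡ c * ∑ˢ X h
  ∑ˢ-*ˡ []      c h = refl
  ∑ˢ-*ˡ (x ∷ X) c h = trans (cong₂ _+_ (∑ˢ-*ˡ X c _) (∑ˢ-*ˡ X c _)) (sym (ℤₚ.*-distribˡ-+ c (∑ˢ X _) (∑ˢ X _)))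

  ∑ˢ-*ʳ : ∀ (X : List S) c h → ∑ˢ X (λ A B → h A B * c) ≡ ∑ˢ X h * c
  ∑ˢ-*ʳ []      c h = refl
  ∑ˢ-*ʳ (x ∷ X) c h = trans (cong₂ _+_ (∑ˢ-*ʳ X c _) (∑ˢ-*ʳ X c _)) (sym (ℤₚ.*-distribʳ-+ c (∑ˢ X _) (∑ˢ X _)))

  ∑ˢ-- : ∀ (X : List S) g h → ∑ˢ X (λ A B → g A B - h A B) ≡ ∑ˢ X g - ∑ˢ X h
  ∑ˢ-- []      g h = refl
  ∑ˢ-- (x ∷ X) g h = trans (cong₂ _+_ (∑ˢ-- X _ _) (∑ˢ-- X _ _)) (lemma (∑ˢ X _) (∑ˢ X _) (∑ˢ X _) (∑ˢ X _))
    where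
    lemma : ∀ x y u v → x - y + (u - v) ≡ x + u - (y + v)
    lemma = solve-∀

  ∑ˢ-zero : ∀ (X : List S) {h} → (∀ {A B} → Interleaving A B X → h A B ≡ 0ℤ) → ∑ˢ X h ≡ 0ℤ
  ∑ˢ-zero []      p = p []
  ∑ˢ-zero (x ∷ X) p = cong₂ _+_ (∑ˢ-zero X (p ∘ consˡ)) (∑ˢ-zero X (p ∘ consʳ))

  ∑ˢ-comm : ∀ (X : List S) h → ∑ˢ X h ≡ ∑ˢ X (λ A B → h B A)
  ∑ˢ-comm []      h = refl
  ∑ˢ-comm (x ∷ X) h = trans (ℤₚ.+-comm (∑ˢ X _) (∑ˢ X _)) (cong₂ _+_ (∑ˢ-comm X _) (∑ˢ-comm X _))

  -- Both sides run over the ways of splitting `X` into three lists.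
  ∑ˢ-assoc : ∀ (X : List S) (h : List S → List S → List S → ℤ) →
             ∑ˢ X (λ D C → ∑ˢ D (λ A B → h A B C)) ≡ ∑ˢ X (λ A D → ∑ˢ D (λ B C → h A B C))
  ∑ˢ-assoc []      h = refl
  ∑ˢ-assoc (x ∷ X) h = begin
    ∑ˢ X (λ D C → ∑ˢ D (λ A B → h (x ∷ A) B C) + ∑ˢ D (λ A B → h A (x ∷ B) C))
      + ∑ˢ X (λ D C → ∑ˢ D (λ A B → h A B (x ∷ C)))
      ≡⟨ cong (_+ ∑ˢ X (λ D C → ∑ˢ D (λ A B → h A B (x ∷ C)))) (∑ˢ-+ X _ _) ⟩
    ∑ˢ X (λ D C → ∑ˢ D (λ A B → h (x ∷ A) B C)) + ∑ˢ X (λ D C → ∑ˢ D (λ A B → h A (x ∷ B) C))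
      + ∑ˢ X (λ D C → ∑ˢ D (λ A B → h A B (x ∷ C)))
      ≡⟨ cong₂ _+_ (cong₂ _+_ (∑ˢ-assoc X _) (∑ˢ-assoc X _)) (∑ˢ-assoc X _) ⟩
    ∑ˢ X (λ A D → ∑ˢ D (λ B C → h (x ∷ A) B C)) + ∑ˢ X (λ A D → ∑ˢ D (λ B C → h A (x ∷ B) C))
      + ∑ˢ X (λ A D → ∑ˢ D (λ B C → h A B (x ∷ C)))
      ≡⟨ ℤₚ.+-assoc (∑ˢ X _) (∑ˢ X _) (∑ˢ X _) ⟩
    ∑ˢ X (λ A D → ∑ˢ D (λ B C → h (x ∷ A) B C)) + (∑ˢ X (λ A D → ∑ˢ D (λ B C → h A (x ∷ B) C))
      + ∑ˢ X (λ A D → ∑ˢ D (λ B C → h A B (x ∷ C))))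
      ≡⟨ +-congˡ (∑ˢ X (λ A D → ∑ˢ D (λ B C → h (x ∷ A) B C))) (∑ˢ-+ X _ _) ⟨
    ∑ˢ (x ∷ X) (λ A D → ∑ˢ D (λ B C → h A B C)) ∎

  ∑ˢ-[]ˡ : ∀ (X : List S) {h} → (∀ {x A B} → Interleaving (x ∷ A) B X → h (x ∷ A) B ≡ 0ℤ) → ∑ˢ X h ≡ h [] X
  ∑ˢ-[]ˡ []      p = refl
  ∑ˢ-[]ˡ (x ∷ X) p = trans (cong₂ _+_ (∑ˢ-zero X (p ∘ consˡ)) (∑ˢ-[]ˡ X (p ∘ consʳ))) (ℤₚ.+-identityˡ _)

  -- The first letter goes to one side or the other, which is the product rule.
  ∑ˢ-⊙ : ∀ a b (X : List S) → ∑ˢ X (λ A B → a (length A) * b (length B)) ≡ (a ⊙ b) (length X)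
  ∑ˢ-⊙ a b []      = refl
  ∑ˢ-⊙ a b (x ∷ X) = cong₂ _+_ (∑ˢ-⊙ (∂ a) b X) (∑ˢ-⊙ a (∂ b) X)

  -- Weights and power series in the integration operator

  -- A weight stands for an exponential generating function whose coefficients may depend on the labels. Then a ⋄ F
  -- is its product with Σ aₙ xⁿ / n!, J is integration, the largest label being the new one, and a ✶ F = Σ aₙ Jⁿ F.
  Weight : Set
  Weight = List ℕ → ℤ

  infixr 7 _⋄_ _✶_

  _⋄_ : Seq → Weight → Weight
  (a ⋄ F) X = ∑ˢ X (λ A B → a (length A) * F B)

  _✶_ : Seq → Weight → Weight
  (a ✶ F) []      = a 0 * F []
  (a ✶ F) (x ∷ X) = a 0 * F (x ∷ X) + (∂ a ✶ F) X

  J : Weight → Weight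
  J F []      = 0ℤ
  J F (x ∷ X) = F X

  δ : Weight
  δ []      = 1ℤ
  δ (_ ∷ _) = 0ℤ

  -- `a ✶ F` evaluates `F` at suffixes of `X` only. The equality is asked for on short decreasing
  -- lists because the later induction provides it just there.
  ✶-cong : ∀ a {F G X} → Decreasing X → (∀ {Z} → length Z ≤ length X → Decreasing Z → F Z ≡ G Z) →
           (a ✶ F) X ≡ (a ✶ G) X
  ✶-cong a {X = []}    []       p = cong (a 0 *_) (p z≤n [])
  ✶-cong a {X = x ∷ X} (d ∷ ds) p =
    cong₂ _+_ (cong (a 0 *_) (p ℕₚ.≤-refl (d ∷ ds))) (✶-cong (∂ a) ds (p ∘ ℕₚ.m≤n⇒m≤1+n))

  ✶-congˡ : ∀ {a b} → a ≗ b → ∀ F X → (a ✶ F) X ≡ (b ✶ F) X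
  ✶-congˡ p F []      = cong (_* F []) (p 0)
  ✶-congˡ p F (x ∷ X) = cong₂ _+_ (cong (_* F (x ∷ X)) (p 0)) (✶-congˡ (p ∘ suc) F X)

  ✶-linearˡ : ∀ c a b F X → ((λ i → c * a i + b i) ✶ F) X ≡ c * (a ✶ F) X + (b ✶ F) X
  ✶-linearˡ c a b F []      = lemma c (a 0) (b 0) (F [])
    where
    lemma : ∀ c x y z → (c * x + y) * z ≡ c * (x * z) + y * z
    lemma = solve-∀
  ✶-linearˡ c a b F (x ∷ X) =
    trans (+-congˡ ((c * a 0 + b 0) * F (x ∷ X)) (✶-linearˡ c (∂ a) (∂ b) F X))
          (lemma c (a 0) (b 0) (F (x ∷ X)) ((∂ a ✶ F) X) ((∂ b ✶ F) X))
    where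
    lemma : ∀ c x y z u v → (c * x + y) * z + (c * u + v) ≡ c * (x * z + u) + (y * z + v)
    lemma = solve-∀

  ✶-neg : ∀ a F X → ((λ i → - a i) ✶ F) X ≡ - (a ✶ F) X
  ✶-neg a F []      = sym (ℤₚ.neg-distribˡ-* (a 0) (F []))
  ✶-neg a F (x ∷ X) = trans (+-congˡ (- a 0 * F (x ∷ X)) (✶-neg (∂ a) F X)) (lemma (a 0) (F (x ∷ X)) ((∂ a ✶ F) X))
    where
    lemma : ∀ x y z → - x * y + - z ≡ - (x * y + z)
    lemma = solve-∀

  -- On weights that depend only on the length, integration shifts the index, so `✶` becomes the
  -- Cauchy product.
  ✶-length : ∀ a b X → (a ✶ (b ∘ length)) X ≡ (a ⊛ b) (length X)
  ✶-length a b []      = refl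
  ✶-length a b (x ∷ X) = +-congˡ (a 0 * b (suc (length X))) (✶-length (∂ a) b X)

  -- Power series in J multiply like ordinary power series: a(J) J b(J) = J (a b)(J), and the outer
  -- J removes `y`.
  ✶-J-✶ : ∀ a b F y X → (a ✶ J (b ✶ F)) (y ∷ X) ≡ ((a ⊛ b) ✶ F) X
  ✶-J-✶ a b F y []      = lemma (a 0) (b 0) (F []) (a 1)
    where
    lemma : ∀ x y z u → x * (y * z) + u * 0ℤ ≡ x * y * z
    lemma = solve-∀
  ✶-J-✶ a b F y (x ∷ X) = begin
    a 0 * (b 0 * F (x ∷ X) + (∂ b ✶ F) X) + (∂ a ✶ J (b ✶ F)) (x ∷ X)
      ≡⟨ +-congˡ (a 0 * (b 0 * F (x ∷ X) + (∂ b ✶ F) X)) (✶-J-✶ (∂ a) b F x X) ⟩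
    a 0 * (b 0 * F (x ∷ X) + (∂ b ✶ F) X) + ((∂ a ⊛ b) ✶ F) X
      ≡⟨ lemma (a 0) (b 0) (F (x ∷ X)) ((∂ b ✶ F) X) (((∂ a ⊛ b) ✶ F) X) ⟩
    a 0 * b 0 * F (x ∷ X) + (a 0 * (∂ b ✶ F) X + ((∂ a ⊛ b) ✶ F) X)
      ≡⟨ +-congˡ (a 0 * b 0 * F (x ∷ X)) (✶-linearˡ (a 0) (∂ b) (∂ a ⊛ b) F X) ⟨
    a 0 * b 0 * F (x ∷ X) + (∂ (a ⊛ b) ✶ F) X ∎
    where
    lemma : ∀ x y z u v → x * (y * z + u) + v ≡ x * y * z + (x * u + v)
    lemma = solve-∀

  Y₀ : Weight → Weight
  Y₀ F = J (β ✶ F)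

  Y₀-cong : ∀ {F G X} → Decreasing X → (∀ {Z} → length Z ≤ length X → Decreasing Z → F Z ≡ G Z) → Y₀ F X ≡ Y₀ G X
  Y₀-cong []       p = refl
  Y₀-cong (d ∷ ds) p = ✶-cong β ds (p ∘ ℕₚ.m≤n⇒m≤1+n)

  -- The quadratic equation of `β` at z = J reads 1 - (J β(J))² = β(J). Lists with fewer than two
  -- letters are treated directly, since J² vanishes on them.
  Y₀-quadratic : ∀ F X → F X - Y₀ (Y₀ F) X ≡ (β ✶ F) X
  Y₀-quadratic F []      = lemma (F [])
    where
    lemma : ∀ x → x - 0ℤ ≡ 1ℤ * x
    lemma = solve-∀
  Y₀-quadratic F (x ∷ []) = lemma (F (x ∷ [])) (F [])
    where
    lemma : ∀ x y → x - 1ℤ * 0ℤ ≡ 1ℤ * x + 0ℤ * y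
    lemma = solve-∀
  Y₀-quadratic F (x ∷ y ∷ X) = begin
    F (x ∷ y ∷ X) - (β ✶ J (β ✶ F)) (y ∷ X)
      ≡⟨ cong (λ z → F (x ∷ y ∷ X) - z) (✶-J-✶ β β F y X) ⟩
    F (x ∷ y ∷ X) - ((β ⊛ β) ✶ F) X
      ≡⟨ cong (λ z → F (x ∷ y ∷ X) - z) (trans (✶-congˡ β-⊛ F X) (✶-neg (∂ (∂ β)) F X)) ⟩
    F (x ∷ y ∷ X) - - (∂ (∂ β) ✶ F) X
      ≡⟨ lemma (F (x ∷ y ∷ X)) (F (y ∷ X)) ((∂ (∂ β) ✶ F) X) ⟩
    1ℤ * F (x ∷ y ∷ X) + (0ℤ * F (y ∷ X) + (∂ (∂ β) ✶ F) X) ∎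
    where
    lemma : ∀ x y z → x - - z ≡ 1ℤ * x + (0ℤ * y + z)
    lemma = solve-∀

  -- The quadratic equation again, now with `β` also as the argument; on the empty list both sides
  -- vanish because `β 1` is 0.
  Y₀-β : ∀ X → Y₀ (β ∘ length) X ≡ - β (suc (length X))
  Y₀-β []      = refl
  Y₀-β (x ∷ X) = trans (✶-length β β X) (β-⊛ (length X))

  ⋄-δ : ∀ a X → (a ⋄ δ) X ≡ a (length X)
  ⋄-δ a X = begin
    ∑ˢ X (λ A B → a (length A) * δ B)  ≡⟨ ∑ˢ-comm X _ ⟩
    ∑ˢ X (λ B A → a (length A) * δ B)  ≡⟨ ∑ˢ-[]ˡ X (λ {_} {_} {B} _ → ℤₚ.*-zeroʳ (a (length B))) ⟩
    a (length X) * 1ℤ                   ≡⟨ ℤₚ.*-identityʳ (a (length X)) ⟩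
    a (length X)                        ∎

  -- Solving the recurrence of valid trees

  module Riccati (t : List ℕ → List ℕ → ℤ) where

    -- `t B A` stands for the number of trees on `B` below whose first leaf `A` can be hung, so
    -- `Y F` counts trees that carry an `F`-structure there.
    Y : Weight → Weight
    Y F X = ∑ˢ X (λ B A → t B A * F A)

    W : Weight
    W B = t B []

    module _
      (Y-[] : ∀ F → Y F [] ≡ 0ℤ)
      (Y-∷ : ∀ F {x X} → Decreasing (x ∷ X) → Y F (x ∷ X) ≡ F X + ∑ˢ X (λ E D → Y F E * W D) - Y (Y F) X)
      where

      Y-δ : ∀ X → Y δ X ≡ W X
      Y-δ X = begin
        ∑ˢ X (λ B A → t B A * δ A)  ≡⟨ ∑ˢ-comm X _ ⟩
        ∑ˢ X (λ A B → t B A * δ A)  ≡⟨ ∑ˢ-[]ˡ X (λ {x} {A} {B} _ → ℤₚ.*-zeroʳ (t B (x ∷ A))) ⟩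
        W X * 1ℤ                     ≡⟨ ℤₚ.*-identityʳ (W X) ⟩
        W X                          ∎

      -- Proved together with `β⋄Y` by induction on the length bound: `β⋄Y` at `suc n` uses `β⋄W` at
      -- `n`, which is `β⋄Y` at `n` for the weight `δ`.
      β⋄W : ∀ n {Z} → length Z ≤ n → Decreasing Z → (β ⋄ W) Z ≡ - β (suc (length Z))

      -- Differentiating β · Y F gives β′ · Y F + β · F + β · W · Y F - β · Y (Y F). The third term
      -- cancels the first as β · W = - β′, the last is found by induction, and `Y₀-quadratic`
      -- finishes. The weight `F` stays universally quantified because the induction is also applied
      -- to `Y F`.
      β⋄Y : ∀ n {X} → length X ≤ n → Decreasing X → ∀ F → (β ⋄ Y F) X ≡ Y₀ (β ⋄ F) X
      β⋄Y n {[]} _ _ F = trans (ℤₚ.*-identityˡ (Y F [])) (Y-[] F)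
      β⋄Y (suc n) {x ∷ X} (s≤s |X|≤n) dec@(x> ∷ decX) F = begin
        (∂ β ⋄ Y F) X + ∑ˢ X (λ A D → b A * Y F (x ∷ D))
          ≡⟨ +-congˡ ((∂ β ⋄ Y F) X) (∑ˢ-cong X expand) ⟩
        (∂ β ⋄ Y F) X + ∑ˢ X (λ A D → b A * F D + ∑ˢ D (λ E C → b A * (Y F E * W C)) - b A * Y (Y F) D)
          ≡⟨ +-congˡ ((∂ β ⋄ Y F) X) (trans (∑ˢ-- X _ _) (cong (_- (β ⋄ Y (Y F)) X) (∑ˢ-+ X _ _))) ⟩
        (∂ β ⋄ Y F) X + ((β ⋄ F) X + ∑ˢ X (λ A D → ∑ˢ D (λ E C → b A * (Y F E * W C))) - (β ⋄ Y (Y F)) X)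
          ≡⟨ cong₂ (λ u v → (∂ β ⋄ Y F) X + ((β ⋄ F) X + u - v)) middle last ⟩
        (∂ β ⋄ Y F) X + ((β ⋄ F) X + -1ℤ * (∂ β ⋄ Y F) X - Y₀ (Y₀ (β ⋄ F)) X)
          ≡⟨ cancel ((∂ β ⋄ Y F) X) ((β ⋄ F) X) (Y₀ (Y₀ (β ⋄ F)) X) ⟩
        (β ⋄ F) X - Y₀ (Y₀ (β ⋄ F)) X
          ≡⟨ Y₀-quadratic (β ⋄ F) X ⟩
        Y₀ (β ⋄ F) (x ∷ X) ∎
        where
        b : Weight
        b A = β (length A)
        cancel : ∀ x y z → x + (y + -1ℤ * x - z) ≡ y - z
        cancel = solve-∀
        distrib : ∀ b x y z → b * (x + y - z) ≡ b * x + b * y - b * z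
        distrib = solve-∀
        expand : ∀ {A D} → Interleaving A D X →
                 b A * Y F (x ∷ D) ≡ b A * F D + ∑ˢ D (λ E C → b A * (Y F E * W C)) - b A * Y (Y F) D
        expand {A} {D} i = begin
          b A * Y F (x ∷ D)
            ≡⟨ cong (b A *_) (Y-∷ F (proj₂ (All-interleaving i x>) ∷ proj₂ (AllPairs-interleaving i decX))) ⟩
          b A * (F D + ∑ˢ D (λ E C → Y F E * W C) - Y (Y F) D)
            ≡⟨ distrib (b A) (F D) (∑ˢ D (λ E C → Y F E * W C)) (Y (Y F) D) ⟩
          b A * F D + b A * ∑ˢ D (λ E C → Y F E * W C) - b A * Y (Y F) D
            ≡⟨ cong (λ z → b A * F D + z - b A * Y (Y F) D) (∑ˢ-*ˡ D (b A) _) ⟨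
          b A * F D + ∑ˢ D (λ E C → b A * (Y F E * W C)) - b A * Y (Y F) D ∎
        middle : ∑ˢ X (λ A D → ∑ˢ D (λ E C → b A * (Y F E * W C))) ≡ -1ℤ * (∂ β ⋄ Y F) X
        middle = begin
          ∑ˢ X (λ A D → ∑ˢ D (λ E C → b A * (Y F E * W C)))
            ≡⟨ ∑ˢ-cong X (λ {A} {D} _ → trans (∑ˢ-comm D _)
                 (∑ˢ-cong D λ {C} {E} _ → reorder (b A) (Y F E) (W C))) ⟩
          ∑ˢ X (λ A D → ∑ˢ D (λ C E → b A * W C * Y F E))
            ≡⟨ ∑ˢ-assoc X _ ⟨
          ∑ˢ X (λ Z E → ∑ˢ Z (λ A C → b A * W C * Y F E))
            ≡⟨ ∑ˢ-cong X (λ {Z} {E} i → trans (∑ˢ-*ʳ Z (Y F E) _)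
                 (cong (_* Y F E) (β⋄W n (ℕₚ.≤-trans (proj₁ (length-interleaving i)) |X|≤n)
                   (proj₁ (AllPairs-interleaving i decX))))) ⟩
          ∑ˢ X (λ Z E → - β (suc (length Z)) * Y F E)
            ≡⟨ ∑ˢ-cong X (λ {Z} {E} _ → negate (β (suc (length Z))) (Y F E)) ⟩
          ∑ˢ X (λ Z E → -1ℤ * (β (suc (length Z)) * Y F E))
            ≡⟨ ∑ˢ-*ˡ X -1ℤ _ ⟩
          -1ℤ * (∂ β ⋄ Y F) X ∎
          where
          reorder : ∀ x y z → x * (y * z) ≡ x * z * y
          reorder = solve-∀
          negate : ∀ x y → - x * y ≡ -1ℤ * (x * y)
          negate = solve-∀
        last : (β ⋄ Y (Y F)) X ≡ Y₀ (Y₀ (β ⋄ F)) X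
        -- Induction moves `β` first past the outer `Y`, then past the inner one under `Y₀`.
        last = trans (β⋄Y n |X|≤n decX (Y F))
                     (Y₀-cong decX λ |Z|≤ decZ → β⋄Y n (ℕₚ.≤-trans |Z|≤ |X|≤n) decZ F)

      β⋄W n {Z} |Z|≤n decZ = begin
        (β ⋄ W) Z            ≡⟨ ∑ˢ-cong Z (λ {A} {B} _ → cong (β (length A) *_) (Y-δ B)) ⟨
        (β ⋄ Y δ) Z          ≡⟨ β⋄Y n |Z|≤n decZ δ ⟩
        Y₀ (β ⋄ δ) Z         ≡⟨ Y₀-cong decZ (λ {A} _ _ → ⋄-δ β A) ⟩
        Y₀ (β ∘ length) Z    ≡⟨ Y₀-β Z ⟩
        - β (suc (length Z)) ∎

      -- Both β · W and β · ω equal - β′, so β · (W - ω) vanishes. By induction W - ω is zero on all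
      -- shorter lists, which leaves the term with constant coefficient `β 0`, and that is 1.
      W≡ω : ∀ n {X} → length X ≤ n → Decreasing X → W X ≡ ω (length X)
      W≡ω n {X} |X|≤n decX = ℤₚ.i-j≡0⇒i≡j (W X) (ω (length X)) (begin
        W X - ω (length X)
          ≡⟨ ℤₚ.*-identityˡ _ ⟨
        β 0 * (W X - ω (length X))
          ≡⟨ ∑ˢ-[]ˡ X (λ {_} {A} i → trans (cong (λ z → β (suc (length A)) * z) (smaller n |X|≤n i))
               (ℤₚ.*-zeroʳ (β (suc (length A))))) ⟨
        ∑ˢ X (λ A B → β (length A) * (W B - ω (length B)))
          ≡⟨ ∑ˢ-cong X (λ {A} {B} _ → distrib (β (length A)) (W B) (ω (length B))) ⟩
        ∑ˢ X (λ A B → β (length A) * W B - β (length A) * ω (length B))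
          ≡⟨ ∑ˢ-- X _ _ ⟩
        (β ⋄ W) X - ∑ˢ X (λ A B → β (length A) * ω (length B))
          ≡⟨ cong₂ _-_ (β⋄W n |X|≤n decX) (trans (∑ˢ-⊙ β ω X) (β⊙ω (length X))) ⟩
        - β (suc (length X)) - - β (suc (length X))
          ≡⟨ ℤₚ.+-inverseʳ (- β (suc (length X))) ⟩
        0ℤ ∎)
        where
        distrib : ∀ x y z → x * (y - z) ≡ x * y - x * z
        distrib = solve-∀
        smaller : ∀ n → length X ≤ n → ∀ {y A B} → Interleaving (y ∷ A) B X → W B - ω (length B) ≡ 0ℤ
        smaller zero    |X|≤n i = contradiction (ℕₚ.<-≤-trans (length-interleaving-< i) |X|≤n) ℕₚ.n≮0
        smaller (suc n) |X|≤n i = ℤₚ.i≡j⇒i-j≡0 (W≡ω n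
          (ℕₚ.≤-pred (ℕₚ.<-≤-trans (length-interleaving-< i) |X|≤n)) (proj₂ (AllPairs-interleaving i decX)))

  -- Valid trees and their recurrence

  ∑ᴸ : List S → (S → ℤ) → ℤ
  ∑ᴸ []       f = 0ℤ
  ∑ᴸ (x ∷ xs) f = f x + ∑ᴸ xs f

  ∑ᴸ-cong : ∀ (xs : List S) {f g} → (∀ {x} → x ∈ xs → f x ≡ g x) → ∑ᴸ xs f ≡ ∑ᴸ xs g
  ∑ᴸ-cong []       p = refl
  ∑ᴸ-cong (x ∷ xs) p = cong₂ _+_ (p (here refl)) (∑ᴸ-cong xs (p ∘ there))

  ∑ᴸ-zero : ∀ (xs : List S) {f} → (∀ {x} → x ∈ xs → f x ≡ 0ℤ) → ∑ᴸ xs f ≡ 0ℤ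
  ∑ᴸ-zero []       p = refl
  ∑ᴸ-zero (x ∷ xs) p = cong₂ _+_ (p (here refl)) (∑ᴸ-zero xs (p ∘ there))

  ∑ᴸ-++ : ∀ (xs ys : List S) f → ∑ᴸ (xs ++ ys) f ≡ ∑ᴸ xs f + ∑ᴸ ys f
  ∑ᴸ-++ []       ys f = sym (ℤₚ.+-identityˡ _)
  ∑ᴸ-++ (x ∷ xs) ys f = trans (+-congˡ (f x) (∑ᴸ-++ xs ys f)) (sym (ℤₚ.+-assoc (f x) (∑ᴸ xs f) (∑ᴸ ys f)))

  ∑ᴸ-map : ∀ (g : S → T) xs f → ∑ᴸ (map g xs) f ≡ ∑ᴸ xs (f ∘ g)
  ∑ᴸ-map g []       f = refl
  ∑ᴸ-map g (x ∷ xs) f = +-congˡ (f (g x)) (∑ᴸ-map g xs f)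

  ∑ᴸ-concatMap : ∀ (g : S → List T) xs f → ∑ᴸ (concatMap g xs) f ≡ ∑ᴸ xs (λ x → ∑ᴸ (g x) f)
  ∑ᴸ-concatMap g []       f = refl
  ∑ᴸ-concatMap g (x ∷ xs) f = trans (∑ᴸ-++ (g x) (concatMap g xs) f) (+-congˡ (∑ᴸ (g x) f) (∑ᴸ-concatMap g xs f))

  ∑ᴸ-cartesianProduct : ∀ (xs : List S) (ys : List T) f →
                        ∑ᴸ (cartesianProduct xs ys) f ≡ ∑ᴸ xs (λ x → ∑ᴸ ys (λ y → f (x , y)))
  ∑ᴸ-cartesianProduct []       ys f = refl
  ∑ᴸ-cartesianProduct (x ∷ xs) ys f = trans (∑ᴸ-++ (map (x ,_) ys) (cartesianProduct xs ys) f)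
    (cong₂ _+_ (∑ᴸ-map (x ,_) ys f) (∑ᴸ-cartesianProduct xs ys f))

  ∑ᴸ-*ˡ : ∀ (xs : List S) c f → ∑ᴸ xs (λ x → c * f x) ≡ c * ∑ᴸ xs f
  ∑ᴸ-*ˡ []       c f = sym (ℤₚ.*-zeroʳ c)
  ∑ᴸ-*ˡ (x ∷ xs) c f = trans (+-congˡ (c * f x) (∑ᴸ-*ˡ xs c f)) (sym (ℤₚ.*-distribˡ-+ c (f x) (∑ᴸ xs f)))

  ∑ᴸ-*ʳ : ∀ (xs : List S) c f → ∑ᴸ xs (λ x → f x * c) ≡ ∑ᴸ xs f * c
  ∑ᴸ-*ʳ []       c f = sym (ℤₚ.*-zeroˡ c)
  ∑ᴸ-*ʳ (x ∷ xs) c f = trans (+-congˡ (f x * c) (∑ᴸ-*ʳ xs c f)) (sym (ℤₚ.*-distribʳ-+ c (f x) (∑ᴸ xs f)))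

  ∑ᴸ-- : ∀ (xs : List S) f g → ∑ᴸ xs (λ x → f x - g x) ≡ ∑ᴸ xs f - ∑ᴸ xs g
  ∑ᴸ-- []       f g = refl
  ∑ᴸ-- (x ∷ xs) f g = trans (+-congˡ (f x - g x) (∑ᴸ-- xs f g)) (lemma (f x) (g x) (∑ᴸ xs f) (∑ᴸ xs g))
    where
    lemma : ∀ x y u v → x - y + (u - v) ≡ x + u - (y + v)
    lemma = solve-∀

  ∑ᴸ-1 : ∀ (xs : List S) → ∑ᴸ xs (λ _ → 1ℤ) ≡ + length xs
  ∑ᴸ-1 []       = refl
  ∑ᴸ-1 (x ∷ xs) = +-congˡ 1ℤ (∑ᴸ-1 xs)

  𝟙 : ∀ {p} {P : Set p} → Dec P → ℤ
  𝟙 (yes _) = 1ℤ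
  𝟙 (no _)  = 0ℤ

  ∑ᴸ-filter : ∀ {p} {P : S → Set p} (P? : Decidable P) xs f → ∑ᴸ (filter P? xs) f ≡ ∑ᴸ xs (λ x → 𝟙 (P? x) * f x)
  ∑ᴸ-filter P? []       f = refl
  ∑ᴸ-filter P? (x ∷ xs) f with P? x
  ... | yes _ = cong₂ _+_ (sym (ℤₚ.*-identityˡ (f x))) (∑ᴸ-filter P? xs f)
  ... | no  _ = trans (∑ᴸ-filter P? xs f) (lemma (f x) _)
    where
    lemma : ∀ x y → y ≡ 0ℤ * x + y
    lemma = solve-∀

  splits : List S → List (List S × List S)
  splits []      = ([] , []) ∷ []
  splits (x ∷ X) = map (λ (A , B) → x ∷ A , B) (splits X) ++ map (λ (A , B) → A , x ∷ B) (splits X)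

  ∑ᴸ-splits : ∀ (X : List S) f → ∑ᴸ (splits X) f ≡ ∑ˢ X (λ A B → f (A , B))
  ∑ᴸ-splits []      f = ℤₚ.+-identityʳ _
  ∑ᴸ-splits (x ∷ X) f = trans (∑ᴸ-++ (map _ (splits X)) _ f)
    (cong₂ _+_ (trans (∑ᴸ-map _ (splits X) f) (∑ᴸ-splits X _)) (trans (∑ᴸ-map _ (splits X) f) (∑ᴸ-splits X _)))

  ∈-splits⁻ : ∀ (X : List S) {A B} → (A , B) ∈ splits X → Interleaving A B X
  ∈-splits⁻ []      (here refl) = []
  ∈-splits⁻ (x ∷ X) p with ∈-++⁻ (map _ (splits X)) p
  ... | inj₁ q with ∈-map⁻ _ q
  ...   | _ , r , refl = consˡ (∈-splits⁻ X r)
  ∈-splits⁻ (x ∷ X) p | inj₂ q with ∈-map⁻ _ q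
  ...   | _ , r , refl = consʳ (∈-splits⁻ X r)

  ∈-splits⁺ : ∀ {A B X : List S} → Interleaving A B X → (A , B) ∈ splits X
  ∈-splits⁺ []        = here refl
  ∈-splits⁺ (consˡ i) = ∈-++⁺ˡ (∈-map⁺ _ (∈-splits⁺ i))
  ∈-splits⁺ (consʳ i) = ∈-++⁺ʳ _ (∈-map⁺ _ (∈-splits⁺ i))

  data FullTree : Set where
    leaf : ℕ → FullTree
    node : FullTree → ℕ → FullTree → FullTree

  root : FullTree → ℕ
  root (leaf x)     = x
  root (node _ x _) = x

  firstLeaf : FullTree → ℕ
  firstLeaf (leaf x)     = x
  firstLeaf (node l _ _) = firstLeaf l

  postorder : FullTree → Word
  postorder (leaf x)     = x ∷ []
  postorder (node l x r) = postorder l ++ postorder r ++ x ∷ []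

  -- The postorder word of a valid tree has a descent after the left subtree of
  -- every inner node, and hence as many descents as possible.
  data Valid : FullTree → Set where
    leaf : ∀ {x} → Valid (leaf x)
    node : ∀ {l x r} → Valid l → Valid r → root l < x → root r < x → firstLeaf r < root l → Valid (node l x r)

  root∈postorder : ∀ T → root T ∈ postorder T
  root∈postorder (leaf x)     = here refl
  root∈postorder (node l x r) = ∈-++⁺ʳ (postorder l) (∈-++⁺ʳ (postorder r) (here refl))

  firstLeaf∈postorder : ∀ T → firstLeaf T ∈ postorder T
  firstLeaf∈postorder (leaf x)     = here refl
  firstLeaf∈postorder (node l x r) = ∈-++⁺ˡ (firstLeaf∈postorder l)

  postorder≤root : ∀ {T} → Valid T → All (_≤ root T) (postorder T)
  postorder≤root leaf = ℕₚ.≤-refl ∷ []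
  postorder≤root (node vl vr l<x r<x _) =
    All.++⁺ (All.map (λ y≤ → ℕₚ.≤-trans y≤ (ℕₚ.<⇒≤ l<x)) (postorder≤root vl))
      (All.++⁺ (All.map (λ y≤ → ℕₚ.≤-trans y≤ (ℕₚ.<⇒≤ r<x)) (postorder≤root vr)) (ℕₚ.≤-refl ∷ []))

  joinable? : Decidable (λ ((l , r) : FullTree × FullTree) → firstLeaf r < root l)
  joinable? (l , r) = firstLeaf r ℕₚ.<? root l

  leaves : ℕ → List ℕ → List FullTree
  leaves x []      = leaf x ∷ []
  leaves x (_ ∷ _) = []

  join : ℕ → List FullTree → List FullTree → List FullTree
  join x ls rs = map (λ (l , r) → node l x r) (filter joinable? (cartesianProduct ls rs))

  -- The valid trees whose set of labels is X, for X decreasing of length at most the first argument.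
  treesWithin : ℕ → List ℕ → List FullTree
  treesWithin zero    X       = []
  treesWithin (suc n) []      = []
  treesWithin (suc n) (x ∷ X) =
    leaves x X ++ concatMap (λ (A , B) → join x (treesWithin n A) (treesWithin n B)) (splits X)

  trees : List ℕ → List FullTree
  trees X = treesWithin (length X) X

  -- Correctness of the enumeration of valid trees

  concatMap-cong-∈ : ∀ {f g : S → List T} xs → (∀ {x} → x ∈ xs → f x ≡ g x) → concatMap f xs ≡ concatMap g xs
  concatMap-cong-∈ []       p = refl
  concatMap-cong-∈ (x ∷ xs) p = cong₂ _++_ (p (here refl)) (concatMap-cong-∈ xs (p ∘ there))

  -- The bound only drives the recursion, so subtrees listed under a larger bound agree with
  -- `trees`.
  treesWithin-enough : ∀ {m n} X → length X ≤ m → length X ≤ n → treesWithin m X ≡ treesWithin n X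
  treesWithin-enough {zero}  {zero}  []      _ _ = refl
  treesWithin-enough {zero}  {suc n} []      _ _ = refl
  treesWithin-enough {suc m} {zero}  []      _ _ = refl
  treesWithin-enough {suc m} {suc n} []      _ _ = refl
  treesWithin-enough {suc m} {suc n} (x ∷ X) (s≤s p) (s≤s q) =
    cong (leaves x X ++_) (concatMap-cong-∈ (splits X) λ { {A , B} AB∈ →
      let a , b = length-interleaving (∈-splits⁻ X AB∈) in
      cong₂ (join x) (treesWithin-enough A (ℕₚ.≤-trans a p) (ℕₚ.≤-trans a q))
                     (treesWithin-enough B (ℕₚ.≤-trans b p) (ℕₚ.≤-trans b q)) })

  ∈-join⁻ : ∀ {x T} ls rs → T ∈ join x ls rs →
            ∃ λ l → ∃ λ r → T ≡ node l x r × l ∈ ls × r ∈ rs × firstLeaf r < root l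
  ∈-join⁻ ls rs p with ∈-map⁻ _ p
  ... | (l , r) , q , refl with ∈-filter⁻ joinable? q
  ...   | lr∈ , lt with ∈-cartesianProduct⁻ ls rs lr∈
  ...     | l∈ , r∈ = l , r , refl , l∈ , r∈ , lt

  ∈-join⁺ : ∀ {x ls rs l r} → l ∈ ls → r ∈ rs → firstLeaf r < root l → node l x r ∈ join x ls rs
  ∈-join⁺ l∈ r∈ lt = ∈-map⁺ _ (∈-filter⁺ joinable? (∈-cartesianProduct⁺ l∈ r∈) lt)

  treesWithin-sound : ∀ n {X T} → Decreasing X → T ∈ treesWithin n X → Valid T × postorder T ↭ X
  treesWithin-sound (suc n) {x ∷ X} (x> ∷ decX) T∈ with ∈-++⁻ (leaves x X) T∈
  treesWithin-sound (suc n) {x ∷ []} (x> ∷ decX) T∈ | inj₁ (here refl) = leaf , ↭-refl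
  ... | inj₂ p with find (∈-concatMap⁻ _ {xs = splits X} p)
  ...   | (A , B) , AB∈ , q with ∈-join⁻ (treesWithin n A) (treesWithin n B) q
  ...     | l , r , refl , l∈ , r∈ , lt =
    node (proj₁ Vl) (proj₁ Vr) (below (proj₁ (All-interleaving i x>)) (proj₂ Vl) (root∈postorder l))
      (below (proj₂ (All-interleaving i x>)) (proj₂ Vr) (root∈postorder r)) lt ,
    ↭-trans (↭-reflexive (sym (++-assoc (postorder l) (postorder r) (x ∷ []))))
      (↭-trans (++-comm (postorder l ++ postorder r) (x ∷ []))
        (prep x (↭-trans (++⁺ (proj₂ Vl) (proj₂ Vr)) (↭-sym (toPermutation i)))))
    where
    i = ∈-splits⁻ X AB∈
    Vl = treesWithin-sound n (proj₁ (AllPairs-interleaving i decX)) l∈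
    Vr = treesWithin-sound n (proj₂ (AllPairs-interleaving i decX)) r∈
    below : ∀ {C y w} → All (_< x) C → w ↭ C → y ∈ w → y < x
    below C< w↭C y∈w = All.lookup C< (∈-resp-↭ w↭C y∈w)

  -- Recovers the split of the labels from the words of the two subtrees: each letter of `X` is
  -- located in `u` or in `v` and removed there.
  ++-↭⇒interleaving : ∀ {u v : List S} X → u ++ v ↭ X →
                      ∃ λ A → ∃ λ B → Interleaving A B X × u ↭ A × v ↭ B
  ++-↭⇒interleaving {u = []}    {[]}    [] _ = [] , [] , [] , ↭-refl , ↭-refl
  ++-↭⇒interleaving {u = []}    {_ ∷ _} [] p with () ← ↭-empty-inv p
  ++-↭⇒interleaving {u = _ ∷ _}         [] p with () ← ↭-empty-inv p
  ++-↭⇒interleaving {u = u} {v} (x ∷ X) p with ∈-++⁻ u (∈-resp-↭ (↭-sym p) (here refl))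
  ... | inj₁ x∈u with u₁ , u₂ , refl ← ∈-∃++ x∈u
    with A , B , i , u↭A , v↭B ← ++-↭⇒interleaving {u = u₁ ++ u₂} X
           (drop-∷ (↭-trans (++⁺ (↭-sym (shift x u₁ u₂)) ↭-refl) p))
    = x ∷ A , B , consˡ i , ↭-trans (shift x u₁ u₂) (prep x u↭A) , v↭B
  ... | inj₂ x∈v with v₁ , v₂ , refl ← ∈-∃++ x∈v
    with A , B , i , u↭A , v↭B ← ++-↭⇒interleaving {u = u} X
           (drop-∷ (↭-trans (↭-sym (↭-trans (++⁺ (↭-refl {x = u}) (shift x v₁ v₂)) (shift x u (v₁ ++ v₂)))) p))
    = A , x ∷ B , consʳ i , u↭A , ↭-trans (shift x v₁ v₂) (prep x v↭B)

  decreasing-head : ∀ {x X y} → Decreasing (x ∷ X) → y ∈ x ∷ X → y ≤ x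
  decreasing-head _        (here refl) = ℕₚ.≤-refl
  decreasing-head (x> ∷ _) (there y∈)  = ℕₚ.<⇒≤ (All.lookup x> y∈)

  treesWithin-complete : ∀ n {X T} → Decreasing X → length X ≤ n → Valid T → postorder T ↭ X → T ∈ treesWithin n X
  treesWithin-complete zero    {[]} {T} _ _ _ T↭X with () ← subst (root T ∈_) (↭-empty-inv T↭X) (root∈postorder T)
  treesWithin-complete (suc n) {[]} {T} _ _ _ T↭X with () ← subst (root T ∈_) (↭-empty-inv T↭X) (root∈postorder T)
  treesWithin-complete (suc n) {x ∷ X} _ _ leaf T↭X with refl ← ↭-singleton-inv (↭-sym T↭X) = here refl
  treesWithin-complete (suc n) {x ∷ X} {node l y r} dec@(x> ∷ decX) (s≤s |X|≤n) v@(node vl vr _ _ lt) T↭X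
    -- The root is the largest label of the tree and `x` is the largest element of the list.
    with refl ← ℕₚ.≤-antisym (decreasing-head dec (∈-resp-↭ T↭X (root∈postorder (node l y r))))
                  (All.lookup (postorder≤root v) (∈-resp-↭ (↭-sym T↭X) (here refl)))
    with A , B , i , l↭A , r↭B ← ++-↭⇒interleaving {u = postorder l} X (drop-∷ (↭-trans
           (↭-trans (++-comm (y ∷ []) (postorder l ++ postorder r))
             (↭-reflexive (++-assoc (postorder l) (postorder r) (y ∷ [])))) T↭X))
    = ∈-++⁺ʳ (leaves x X) (∈-concatMap⁺ _ (lose (∈-splits⁺ i) (∈-join⁺
        (treesWithin-complete n (proj₁ (AllPairs-interleaving i decX))
          (ℕₚ.≤-trans (proj₁ (length-interleaving i)) |X|≤n) vl l↭A)
        (treesWithin-complete n (proj₂ (AllPairs-interleaving i decX))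
          (ℕₚ.≤-trans (proj₂ (length-interleaving i)) |X|≤n) vr r↭B)
        lt)))

  decreasing-↭⇒≡ : ∀ {X Y} → Decreasing X → Decreasing Y → X ↭ Y → X ≡ Y
  decreasing-↭⇒≡ {[]}    {Y}     _ _ p = sym (↭-empty-inv (↭-sym p))
  decreasing-↭⇒≡ {_ ∷ _} {[]}    _ _ p with () ← ↭-empty-inv p
  decreasing-↭⇒≡ {x ∷ X} {y ∷ Y} dX@(_ ∷ decX) dY@(_ ∷ decY) p
    with refl ← ℕₚ.≤-antisym (decreasing-head dY (∈-resp-↭ p (here refl)))
                             (decreasing-head dX (∈-resp-↭ (↭-sym p) (here refl)))
    = cong (x ∷_) (decreasing-↭⇒≡ decX decY (drop-∷ p))

  concatMap-unique : ∀ {f : S → List T} {xs} → Unique xs → (∀ {x} → x ∈ xs → Unique (f x)) →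
                     (∀ {x y z} → x ∈ xs → y ∈ xs → z ∈ f x → z ∈ f y → x ≡ y) → Unique (concatMap f xs)
  concatMap-unique         []         uf inj = []
  concatMap-unique {f = f} {x ∷ xs} (x∉ ∷ uxs) uf inj = Unique.++⁺ (uf (here refl))
    (concatMap-unique uxs (uf ∘ there) λ x∈ y∈ → inj (there x∈) (there y∈))
    λ { (z∈fx , z∈) → let y , y∈ , z∈fy = find (∈-concatMap⁻ f {xs = xs} z∈) in
        All.lookup x∉ y∈ (inj (here refl) (there y∈) z∈fx z∈fy) }

  splits-unique : ∀ {X : List S} → Unique X → Unique (splits X)
  splits-unique []         = [] ∷ []
  splits-unique {X = x ∷ X} (x∉ ∷ uX) = Unique.++⁺
    (Unique.map⁺ (λ { refl → refl }) (splits-unique uX)) (Unique.map⁺ (λ { refl → refl }) (splits-unique uX))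
    λ { (p , q) → disjoint (∈-map⁻ _ p) (∈-map⁻ _ q) }
    where
    disjoint : ∀ {z} → (∃ λ AB → AB ∈ splits X × z ≡ (x ∷ proj₁ AB , proj₂ AB)) →
               (∃ λ AB → AB ∈ splits X × z ≡ (proj₁ AB , x ∷ proj₂ AB)) → ⊥
    disjoint (_ , _ , refl) (_ , q , refl) =
      All.lookup x∉ (∈-resp-↭ (↭-sym (toPermutation (∈-splits⁻ X q))) (here refl)) refl

  leaves-unique : ∀ x X → Unique (leaves x X)
  leaves-unique x []      = [] ∷ []
  leaves-unique x (_ ∷ _) = []

  treesWithin-unique : ∀ n {X} → Decreasing X → Unique (treesWithin n X)
  treesWithin-unique zero    _ = []
  treesWithin-unique (suc n) {[]}    _ = []
  treesWithin-unique (suc n) {x ∷ X} (x> ∷ decX) = Unique.++⁺ (leaves-unique x X)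
    (concatMap-unique (splits-unique (AllPairs.map (λ y< y≡ → ℕₚ.<⇒≢ y< (sym y≡)) decX))
      joins-unique joins-disjoint)
    (λ (p , q) → leaf≢node X p (find (∈-concatMap⁻ _ {xs = splits X} q)))
    where
    f : List ℕ × List ℕ → List FullTree
    f (A , B) = join x (treesWithin n A) (treesWithin n B)
    joins-unique : ∀ {AB} → AB ∈ splits X → Unique (f AB)
    joins-unique AB∈ = let A , B = AllPairs-interleaving (∈-splits⁻ X AB∈) decX in
      Unique.map⁺ (λ { refl → refl }) (Unique.filter⁺ joinable?
        (Unique.cartesianProduct⁺ (treesWithin-unique n A) (treesWithin-unique n B)))
    -- The labels of the two subtrees determine the split, since a decreasing list is determined by
    -- its elements.
    joins-disjoint : ∀ {AB CD T} → AB ∈ splits X → CD ∈ splits X → T ∈ f AB → T ∈ f CD → AB ≡ CD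
    joins-disjoint {A , B} {C , D} AB∈ CD∈ p q
      with _ , _ , refl , l∈A , r∈B , _ ← ∈-join⁻ (treesWithin n A) (treesWithin n B) p
         | _ , _ , refl , l∈C , r∈D , _ ← ∈-join⁻ (treesWithin n C) (treesWithin n D) q =
      let decA , decB = AllPairs-interleaving (∈-splits⁻ X AB∈) decX
          decC , decD = AllPairs-interleaving (∈-splits⁻ X CD∈) decX
          same : ∀ {E F} → Decreasing E → Decreasing F → ∀ {T} → T ∈ treesWithin n E → T ∈ treesWithin n F → E ≡ F
          same decE decF T∈E T∈F = decreasing-↭⇒≡ decE decF
            (↭-trans (↭-sym (proj₂ (treesWithin-sound n decE T∈E))) (proj₂ (treesWithin-sound n decF T∈F)))
      in cong₂ _,_ (same decA decC l∈A l∈C) (same decB decD r∈B r∈D)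
    leaf≢node : ∀ X {T Y} → T ∈ leaves x X → (∃ λ AB → AB ∈ Y × T ∈ f AB) → ⊥
    leaf≢node [] (here refl) ((A , B) , _ , p) with _ , _ , () , _ ← ∈-join⁻ (treesWithin n A) (treesWithin n B) p

  -- The recurrence of valid trees

  -- The number of valid trees on B below whose first leaf the labels A can be hung.
  hang : List ℕ → List ℕ → ℤ
  hang B A = ∑ᴸ (trees B) (λ T → 𝟙 (all? (ℕₚ._≤? firstLeaf T) A))

  open Riccati hang

  trees-sound : ∀ {X T} → Decreasing X → T ∈ trees X → Valid T × postorder T ↭ X
  trees-sound {X} = treesWithin-sound (length X)

  -- The first leaf of a node is that of its left subtree, so the condition on `A` concerns `l`
  -- alone.
  hang-∷ : ∀ x B A → hang (x ∷ B) A ≡ ∑ᴸ (leaves x B) (λ T → 𝟙 (all? (ℕₚ._≤? firstLeaf T) A)) +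
    ∑ˢ B (λ C D → ∑ᴸ (trees C) λ l → ∑ᴸ (trees D) λ r →
      𝟙 (firstLeaf r ℕₚ.<? root l) * 𝟙 (all? (ℕₚ._≤? firstLeaf l) A))
  hang-∷ x B A = begin
    hang (x ∷ B) A
      ≡⟨ ∑ᴸ-++ (leaves x B) _ f ⟩
    ∑ᴸ (leaves x B) f + ∑ᴸ (concatMap (λ (C , D) → join x (ts C) (ts D)) (splits B)) f
      ≡⟨ +-congˡ (∑ᴸ (leaves x B) f) (trans (∑ᴸ-concatMap _ (splits B) f) (∑ᴸ-splits B _)) ⟩
    ∑ᴸ (leaves x B) f + ∑ˢ B (λ C D → ∑ᴸ (join x (ts C) (ts D)) f)
      ≡⟨ +-congˡ (∑ᴸ (leaves x B) f) (∑ˢ-cong B step) ⟩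
    ∑ᴸ (leaves x B) f + ∑ˢ B (λ C D → ∑ᴸ (trees C) λ l → ∑ᴸ (trees D) λ r → 𝟙 (joinable? (l , r)) * f l) ∎
    where
    f : FullTree → ℤ
    f T = 𝟙 (all? (ℕₚ._≤? firstLeaf T) A)
    ts : List ℕ → List FullTree
    ts = treesWithin (length B)
    step : ∀ {C D} → Interleaving C D B →
           ∑ᴸ (join x (ts C) (ts D)) f ≡ ∑ᴸ (trees C) λ l → ∑ᴸ (trees D) λ r → 𝟙 (joinable? (l , r)) * f l
    step {C} {D} i = begin
      ∑ᴸ (join x (ts C) (ts D)) f
        ≡⟨ trans (∑ᴸ-map _ (filter joinable? (cartesianProduct (ts C) (ts D))) f)
                 (∑ᴸ-filter joinable? (cartesianProduct (ts C) (ts D)) _) ⟩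
      ∑ᴸ (cartesianProduct (ts C) (ts D)) (λ (l , r) → 𝟙 (joinable? (l , r)) * f l)
        ≡⟨ ∑ᴸ-cartesianProduct (ts C) (ts D) _ ⟩
      ∑ᴸ (ts C) (λ l → ∑ᴸ (ts D) λ r → 𝟙 (joinable? (l , r)) * f l)
        ≡⟨ cong₂ (λ ls rs → ∑ᴸ ls λ l → ∑ᴸ rs λ r → 𝟙 (joinable? (l , r)) * f l)
             (treesWithin-enough C (proj₁ (length-interleaving i)) ℕₚ.≤-refl)
             (treesWithin-enough D (proj₂ (length-interleaving i)) ℕₚ.≤-refl) ⟩
      ∑ᴸ (trees C) (λ l → ∑ᴸ (trees D) λ r → 𝟙 (joinable? (l , r)) * f l) ∎

  𝟙-yes : ∀ {p} {P : Set p} (P? : Dec P) → P → 𝟙 P? ≡ 1ℤ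
  𝟙-yes (yes _) p = refl
  𝟙-yes (no ¬p) p = contradiction p ¬p

  𝟙-no : ∀ {p} {P : Set p} (P? : Dec P) → ¬ P → 𝟙 P? ≡ 0ℤ
  𝟙-no (yes p) ¬p = contradiction p ¬p
  𝟙-no (no _)  ¬p = refl

  -- The first leaf is one of the labels in `B`, hence smaller than `x`.
  hang-above : ∀ {x B} A → Decreasing B → All (_< x) B → hang B (x ∷ A) ≡ 0ℤ
  hang-above {x} {B} A decB B<x = ∑ᴸ-zero (trees B) λ {T} T∈ →
    𝟙-no (all? (ℕₚ._≤? firstLeaf T) (x ∷ A)) λ { (x≤ ∷ _) →
    ℕₚ.<⇒≱ (All.lookup B<x (∈-resp-↭ (proj₂ (trees-sound decB T∈)) (firstLeaf∈postorder T))) x≤ }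

  -- Provided that A can be hung below l, the labels E of l and A all lie at most
  -- at root l, so the trees l and r violate validity iff E can be hung below r.
  violation : ∀ {C A E l r} → Interleaving C A E → Valid l → postorder l ↭ C →
              𝟙 (firstLeaf r ℕₚ.<? root l) * 𝟙 (all? (ℕₚ._≤? firstLeaf l) A) ≡
              𝟙 (all? (ℕₚ._≤? firstLeaf l) A) * (1ℤ - 𝟙 (all? (ℕₚ._≤? firstLeaf r) E))
  violation {C} {A} {E} {l} {r} i vl l↭C with all? (ℕₚ._≤? firstLeaf l) A
  ... | no _ = ℤₚ.*-zeroʳ (𝟙 (firstLeaf r ℕₚ.<? root l))
  ... | yes A≤ with firstLeaf r ℕₚ.<? root l
  ...   | yes lt = sym (cong (λ z → 1ℤ * (1ℤ - z)) (𝟙-no (all? (ℕₚ._≤? firstLeaf r) E) λ E≤ →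
            ℕₚ.<⇒≱ lt (All.lookup E≤ (∈-resp-↭ (↭-sym (toPermutation i))
              (∈-++⁺ˡ (∈-resp-↭ l↭C (root∈postorder l)))))))
  ...   | no ¬lt = sym (cong (λ z → 1ℤ * (1ℤ - z)) (𝟙-yes (all? (ℕₚ._≤? firstLeaf r) E)
            (All-resp-↭ (↭-sym (toPermutation i)) (All.map (λ y≤ → ℕₚ.≤-trans y≤ (ℕₚ.≮⇒≥ ¬lt))
              (All.++⁺ (All-resp-↭ l↭C (postorder≤root vl))
                (All.map (λ y≤ → ℕₚ.≤-trans y≤ (All.lookup (postorder≤root vl) (firstLeaf∈postorder l))) A≤))))))

  Y-[] : ∀ F → Y F [] ≡ 0ℤ
  Y-[] F = ℤₚ.*-zeroˡ (F [])

  -- The largest label `x` cannot be hung below a leaf, so it is the root. A single leaf contributes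
  -- `F X`; a node contributes all pairs of subtrees minus the pairs that violate validity.
  Y-∷ : ∀ F {x X} → Decreasing (x ∷ X) → Y F (x ∷ X) ≡ F X + ∑ˢ X (λ E D → Y F E * W D) - Y (Y F) X
  Y-∷ F {x} {X} (x> ∷ decX) = begin
    ∑ˢ X (λ B A → hang (x ∷ B) A * F A) + ∑ˢ X (λ B A → hang B (x ∷ A) * F (x ∷ A))
      ≡⟨ +-congˡ (∑ˢ X (λ B A → hang (x ∷ B) A * F A)) (∑ˢ-zero X λ {B} {A} i → cong (_* F (x ∷ A))
           (hang-above A (proj₁ (AllPairs-interleaving i decX)) (proj₁ (All-interleaving i x>)))) ⟩
    ∑ˢ X (λ B A → hang (x ∷ B) A * F A) + 0ℤ
      ≡⟨ ℤₚ.+-identityʳ _ ⟩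
    ∑ˢ X (λ B A → hang (x ∷ B) A * F A)
      ≡⟨ ∑ˢ-cong X (λ {B} {A} _ → trans (cong (_* F A) (hang-∷ x B A))
           (ℤₚ.*-distribʳ-+ (F A) (single B A) (∑ˢ B (pairs A)))) ⟩
    ∑ˢ X (λ B A → single B A * F A + ∑ˢ B (pairs A) * F A)
      ≡⟨ ∑ˢ-+ X _ _ ⟩
    ∑ˢ X (λ B A → single B A * F A) + ∑ˢ X (λ B A → ∑ˢ B (pairs A) * F A)
      ≡⟨ cong₂ _+_ singles splitting ⟩
    F X + (∑ˢ X (λ E D → Y F E * W D) - Y (Y F) X)
      ≡⟨ ℤₚ.+-assoc (F X) (∑ˢ X (λ E D → Y F E * W D)) (- Y (Y F) X) ⟨
    F X + ∑ˢ X (λ E D → Y F E * W D) - Y (Y F) X ∎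
    where
    single : List ℕ → List ℕ → ℤ
    single B A = ∑ᴸ (leaves x B) (λ T → 𝟙 (all? (ℕₚ._≤? firstLeaf T) A))
    pairs : List ℕ → List ℕ → List ℕ → ℤ
    pairs A C D = ∑ᴸ (trees C) λ l → ∑ᴸ (trees D) λ r →
      𝟙 (firstLeaf r ℕₚ.<? root l) * 𝟙 (all? (ℕₚ._≤? firstLeaf l) A)
    singles : ∑ˢ X (λ B A → single B A * F A) ≡ F X
    singles = begin
      ∑ˢ X (λ B A → single B A * F A)  ≡⟨ ∑ˢ-[]ˡ X (λ {_} {_} {A} _ → ℤₚ.*-zeroˡ (F A)) ⟩
      (𝟙 (all? (ℕₚ._≤? x) X) + 0ℤ) * F X
        ≡⟨ cong (λ z → (z + 0ℤ) * F X) (𝟙-yes (all? (ℕₚ._≤? x) X) (All.map ℕₚ.<⇒≤ x>)) ⟩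
      1ℤ * F X                          ≡⟨ ℤₚ.*-identityˡ (F X) ⟩
      F X                               ∎
    -- By `violation`, whether a pair is excluded depends on `r` and `E` but no longer on `l`, so
    -- the double sum factors.
    factor : ∀ {E D C A} → Interleaving E D X → Interleaving C A E →
             pairs A C D * F A ≡ hang C A * F A * (W D - hang D E)
    factor {E} {D} {C} {A} i j = begin
      pairs A C D * F A
        ≡⟨ cong (_* F A) (∑ᴸ-cong (trees C) λ {l} l∈ → trans
             (∑ᴸ-cong (trees D) λ {r} _ → violation {r = r} j (proj₁ (trees-sound decC l∈))
               (proj₂ (trees-sound decC l∈)))
             (trans (∑ᴸ-*ˡ (trees D) (a l) _) (cong (a l *_) (∑ᴸ-- (trees D) _ _)))) ⟩
      ∑ᴸ (trees C) (λ l → a l * (W D - hang D E)) * F A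
        ≡⟨ cong (_* F A) (∑ᴸ-*ʳ (trees C) (W D - hang D E) a) ⟩
      hang C A * (W D - hang D E) * F A
        ≡⟨ swap (hang C A) (W D - hang D E) (F A) ⟩
      hang C A * F A * (W D - hang D E) ∎
      where
      decC = proj₁ (AllPairs-interleaving j (proj₁ (AllPairs-interleaving i decX)))
      a : FullTree → ℤ
      a l = 𝟙 (all? (ℕₚ._≤? firstLeaf l) A)
      swap : ∀ x y z → x * y * z ≡ x * z * y
      swap = solve-∀
    -- The labels fall into three lists: `C` and `D` for the subtrees and `A` hung below. Regrouping
    -- `C` with `A` as `E` lets `factor` apply.
    splitting : ∑ˢ X (λ B A → ∑ˢ B (pairs A) * F A) ≡ ∑ˢ X (λ E D → Y F E * W D) - Y (Y F) X
    splitting = begin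
      ∑ˢ X (λ B A → ∑ˢ B (pairs A) * F A)
        ≡⟨ ∑ˢ-cong X (λ {B} {A} _ → ∑ˢ-*ʳ B (F A) _) ⟨
      ∑ˢ X (λ B A → ∑ˢ B (λ C D → pairs A C D * F A))
        ≡⟨ ∑ˢ-assoc X _ ⟩
      ∑ˢ X (λ C B → ∑ˢ B (λ D A → pairs A C D * F A))
        ≡⟨ ∑ˢ-cong X (λ {_} {B} _ → ∑ˢ-comm B _) ⟩
      ∑ˢ X (λ C B → ∑ˢ B (λ A D → pairs A C D * F A))
        ≡⟨ ∑ˢ-assoc X _ ⟨
      ∑ˢ X (λ E D → ∑ˢ E (λ C A → pairs A C D * F A))
        ≡⟨ ∑ˢ-cong X (λ {E} {D} i → trans (∑ˢ-cong E (factor i)) (trans (∑ˢ-*ʳ E (W D - hang D E) _)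
             (expand (Y F E) (W D) (hang D E)))) ⟩
      ∑ˢ X (λ E D → Y F E * W D - hang D E * Y F E)
        ≡⟨ ∑ˢ-- X _ _ ⟩
      ∑ˢ X (λ E D → Y F E * W D) - ∑ˢ X (λ E D → hang D E * Y F E)
        ≡⟨ cong (λ z → ∑ˢ X (λ E D → Y F E * W D) - z) (∑ˢ-comm X _) ⟩
      ∑ˢ X (λ E D → Y F E * W D) - Y (Y F) X ∎
      where
      expand : ∀ x y z → x * (y - z) ≡ x * y - z * x
      expand = solve-∀

  length-trees : ∀ {X} → Decreasing X → + length (trees X) ≡ ω (length X)
  length-trees {X} decX = trans (sym (∑ᴸ-1 (trees X))) (W≡ω Y-[] Y-∷ (length X) ℕₚ.≤-refl decX)

open import Data.Nat.Base using (_+_; _*_; _⊔_)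

-- Decreasing binary trees

data BinTree : Set where
  nil  : BinTree
  node : BinTree → ℕ → BinTree → BinTree

inorder : BinTree → Word
inorder nil          = []
inorder (node l x r) = inorder l ++ x ∷ inorder r

post : BinTree → Word
post nil          = []
post (node l x r) = post l ++ post r ++ x ∷ []

data Heap : BinTree → Set where
  nil  : Heap nil
  node : ∀ {l x r} → Heap l → Heap r → All (_< x) (inorder l) → All (_< x) (inorder r) → Heap (node l x r)

-- Stack-sorting in terms of decreasing binary trees

if-++ : ∀ b {u u′ v v′ w : List S} → u ≡ u′ ++ w → v ≡ v′ ++ w →
        (if b then u else v) ≡ (if b then u′ else v′) ++ w
if-++ true  p _ = p
if-++ false _ q = q

-- `x` exceeds everything before it, so the stack is emptied before `x` enters.
sortWith-++-max : ∀ L st {x R} → All (_< x) L → All (_< x) st →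
                  sortWith (L ++ x ∷ R) st ≡ sortWith L st ++ sortWith R (x ∷ [])
sortWith-++-max []      []       _ _ = refl
sortWith-++-max []      (t ∷ st) {x} _ (t<x ∷ st<x)
  rewrite dec-false (x ℕₚ.<? t) (ℕₚ.<-asym t<x) = cong (t ∷_) (sortWith-++-max [] st [] st<x)
sortWith-++-max (y ∷ L) []       (y<x ∷ L<x) [] = sortWith-++-max L (y ∷ []) L<x (y<x ∷ [])
sortWith-++-max (y ∷ L) (t ∷ st) (y<x ∷ L<x) (t<x ∷ st<x) = if-++ (does (y ℕₚ.<? t))
  (sortWith-++-max L (y ∷ t ∷ st) L<x (y<x ∷ t<x ∷ st<x))
  (cong (t ∷_) (sortWith-++-max (y ∷ L) st (y<x ∷ L<x) st<x))

-- An entry larger than the whole remaining input is popped only at the very end and blocks no push.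
sortWith-bottom : ∀ R st {x} → All (_< x) R → sortWith R (st ++ x ∷ []) ≡ sortWith R st ++ x ∷ []
sortWith-bottom []      []       _ = refl
sortWith-bottom []      (t ∷ st) _ = cong (t ∷_) (sortWith-bottom [] st [])
sortWith-bottom (y ∷ R) []       {x} (y<x ∷ R<x)
  rewrite dec-true (y ℕₚ.<? x) y<x = sortWith-bottom R (y ∷ []) R<x
sortWith-bottom (y ∷ R) (t ∷ st) (y<x ∷ R<x) = if-++ (does (y ℕₚ.<? t))
  (sortWith-bottom R (y ∷ t ∷ st) R<x)
  (cong (t ∷_) (sortWith-bottom (y ∷ R) st (y<x ∷ R<x)))

s-inorder : ∀ {t} → Heap t → s (inorder t) ≡ post t
s-inorder nil = refl
s-inorder (node {l} {x} {r} hl hr l<x r<x) = begin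
  s (inorder l ++ x ∷ inorder r)                  ≡⟨ sortWith-++-max (inorder l) [] l<x [] ⟩
  s (inorder l) ++ sortWith (inorder r) (x ∷ [])  ≡⟨ cong (s (inorder l) ++_) (sortWith-bottom (inorder r) [] r<x) ⟩
  s (inorder l) ++ s (inorder r) ++ x ∷ []        ≡⟨ cong₂ (λ u v → u ++ v ++ x ∷ []) (s-inorder hl) (s-inorder hr) ⟩
  post l ++ post r ++ x ∷ []                      ∎
  where open ≡-Reasoning

post↭inorder : ∀ t → post t ↭ inorder t
post↭inorder nil          = ↭-refl
post↭inorder (node l x r) = ++⁺ (post↭inorder l) (↭-trans (++-comm (post r) (x ∷ [])) (prep x (post↭inorder r)))

-- One step of building the decreasing tree of a word from right to left: the new first letter
-- descends the left spine until it meets a root that is not larger.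
insert : ℕ → BinTree → BinTree
insert y nil          = node nil y nil
insert y (node l x r) with y ℕₚ.<? x
... | yes _ = node (insert y l) x r
... | no  _ = node nil y (node l x r)

inorder-insert : ∀ y t → inorder (insert y t) ≡ y ∷ inorder t
inorder-insert y nil = refl
inorder-insert y (node l x r) with y ℕₚ.<? x
... | yes _ = cong (_++ x ∷ inorder r) (inorder-insert y l)
... | no  _ = refl

insert-heap : ∀ {y t} → All (y ≢_) (inorder t) → Heap t → Heap (insert y t)
insert-heap y∉ nil = node nil nil [] []
insert-heap {y} {node l x r} y∉ h@(node hl hr l<x r<x) with y ℕₚ.<? x
... | yes y<x = node (insert-heap (All.++⁻ˡ (inorder l) y∉) hl) hr
                     (subst (All (_< x)) (sym (inorder-insert y l)) (y<x ∷ l<x)) r<x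
... | no  y≮x = node nil h [] (All.++⁺ (All.map (λ z<x → ℕₚ.<-trans z<x x<y) l<x)
                                       (x<y ∷ All.map (λ z<x → ℕₚ.<-trans z<x x<y) r<x))
  where
  x<y : x < y
  x<y = ℕₚ.≤∧≢⇒< (ℕₚ.≮⇒≥ y≮x) (All.head (All.++⁻ʳ (inorder l) y∉) ∘ sym)

heap-of : ∀ {σ} → Unique σ → ∃ λ t → Heap t × inorder t ≡ σ
heap-of []       = nil , nil , refl
heap-of {y ∷ σ} (y∉ ∷ uσ) with t , ht , refl ← heap-of uσ = insert y t , insert-heap y∉ ht , inorder-insert y t

-- Full trees among binary trees

⌊_⌋ : FullTree → BinTree
⌊ leaf x ⌋     = node nil x nil
⌊ node l x r ⌋ = node ⌊ l ⌋ x ⌊ r ⌋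

post-⌊⌋ : ∀ T → post ⌊ T ⌋ ≡ postorder T
post-⌊⌋ (leaf x)     = refl
post-⌊⌋ (node l x r) = cong₂ (λ u v → u ++ v ++ x ∷ []) (post-⌊⌋ l) (post-⌊⌋ r)

postorder↭inorder : ∀ T → postorder T ↭ inorder ⌊ T ⌋
postorder↭inorder T = ↭-trans (↭-reflexive (sym (post-⌊⌋ T))) (post↭inorder ⌊ T ⌋)

⌊⌋≢nil : ∀ T → ⌊ T ⌋ ≢ nil
⌊⌋≢nil (leaf _)     ()
⌊⌋≢nil (node _ _ _) ()

root-below : ∀ T {x} → All (_< x) (inorder ⌊ T ⌋) → root T < x
root-below T T<x = All.lookup T<x (∈-resp-↭ (postorder↭inorder T) (root∈postorder T))

inorder-below : ∀ {T x} → Valid T → root T < x → All (_< x) (inorder ⌊ T ⌋)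
inorder-below {T} v T<x =
  All-resp-↭ (postorder↭inorder T) (All.map (λ y≤ → ℕₚ.≤-<-trans y≤ T<x) (postorder≤root v))

heap-⌊⌋ : ∀ {T} → Valid T → Heap ⌊ T ⌋
heap-⌊⌋ leaf                   = node nil nil [] []
heap-⌊⌋ (node vl vr l<x r<x _) = node (heap-⌊⌋ vl) (heap-⌊⌋ vr) (inorder-below vl l<x) (inorder-below vr r<x)

-- The last three constructors are the places where a move preserving the postorder word applies. In
-- `ascent` both subtrees are valid, so no defect lies deeper.
data Defective : BinTree → Set where
  left   : ∀ {l x r} → Defective l → Defective (node l x r)
  right  : ∀ {l x r} → Defective r → Defective (node l x r)
  onlyˡ  : ∀ {l x} → l ≢ nil → Defective (node l x nil)
  onlyʳ  : ∀ {x r} → r ≢ nil → Defective (node nil x r)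
  ascent : ∀ {l x r} → Valid l → Valid r → root l < firstLeaf r → Defective (node ⌊ l ⌋ x ⌊ r ⌋)

unique-++⁻ : ∀ (u : List S) {v} → Unique (u ++ v) → Unique u × Unique v × (∀ {x} → x ∈ u → x ∈ v → ⊥)
unique-++⁻ []      uv        = [] , uv , λ ()
unique-++⁻ (x ∷ u) (x∉ ∷ uv) with uu , vv , disj ← unique-++⁻ u uv =
  All.++⁻ˡ u x∉ ∷ uu , vv , λ { (here refl) y∈v → All.lookup (All.++⁻ʳ u x∉) y∈v refl ; (there y∈u) → disj y∈u }

classify : ∀ {t} → Heap t → Unique (inorder t) → t ≡ nil ⊎ (∃ λ T → Valid T × t ≡ ⌊ T ⌋) ⊎ Defective t
classify nil _ = inj₁ refl
classify (node {l} {x} {r} hl hr l<x r<x) u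
  with ul , _ ∷ ur , disj ← unique-++⁻ (inorder l) u
  with classify hl ul | classify hr ur
... | inj₂ (inj₂ d) | _             = inj₂ (inj₂ (left d))
... | _             | inj₂ (inj₂ d) = inj₂ (inj₂ (right d))
... | inj₁ refl     | inj₁ refl     = inj₂ (inj₁ (leaf x , leaf , refl))
... | inj₁ refl     | inj₂ (inj₁ (R , vR , refl)) = inj₂ (inj₂ (onlyʳ (⌊⌋≢nil R)))
... | inj₂ (inj₁ (L , vL , refl)) | inj₁ refl = inj₂ (inj₂ (onlyˡ (⌊⌋≢nil L)))
... | inj₂ (inj₁ (L , vL , refl)) | inj₂ (inj₁ (R , vR , refl)) with ℕₚ.<-cmp (firstLeaf R) (root L)
...   | tri< lt _ _ = inj₂ (inj₁ (node L x R ,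
          node vL vR (root-below L l<x) (root-below R r<x) lt , refl))
...   | tri> _ _ gt = inj₂ (inj₂ (ascent vL vR gt))
-- Equality would repeat a label in both subtrees.
...   | tri≈ _ eq _ = contradiction
          (there (∈-resp-↭ (postorder↭inorder R) (firstLeaf∈postorder R)))
          (disj (subst (_∈ inorder ⌊ L ⌋) (sym eq) (∈-resp-↭ (postorder↭inorder L) (root∈postorder L))))

-- A defective tree shares its postorder word with another decreasing tree

graft : BinTree → FullTree → BinTree
graft t (leaf y)     = node t y nil
graft t (node l y r) = node (graft t l) y ⌊ r ⌋

-- The postorder word starts at the first leaf, so a tree hung there comes before everything else.
post-graft : ∀ t T → post (graft t T) ≡ post t ++ postorder T
post-graft t (leaf y)     = refl
post-graft t (node l y r) = begin
  post (graft t l) ++ post ⌊ r ⌋ ++ y ∷ []          ≡⟨ cong₂ (λ u v → u ++ v ++ y ∷ []) (post-graft t l) (post-⌊⌋ r) ⟩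
  (post t ++ postorder l) ++ postorder r ++ y ∷ []  ≡⟨ ++-assoc (post t) (postorder l) _ ⟩
  post t ++ postorder l ++ postorder r ++ y ∷ []    ∎
  where open ≡-Reasoning

firstLeaf≤root : ∀ {T} → Valid T → firstLeaf T ≤ root T
firstLeaf≤root {T} v = All.lookup (postorder≤root v) (firstLeaf∈postorder T)

graft-below : ∀ {t T x} → Valid T → All (_< firstLeaf T) (inorder t) → root T < x → All (_< x) (inorder (graft t T))
graft-below {t} {T} v t< T<x = All-resp-↭
  (↭-trans (↭-sym (++⁺ (post↭inorder t) ↭-refl))
    (↭-trans (↭-reflexive (sym (post-graft t T))) (post↭inorder (graft t T))))
  (All.++⁺ (All.map (λ y< → ℕₚ.<-trans (ℕₚ.<-≤-trans y< (firstLeaf≤root v)) T<x) t<)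
           (All.map (λ y≤ → ℕₚ.≤-<-trans y≤ T<x) (postorder≤root v)))

graft-heap : ∀ {t T} → Heap t → Valid T → All (_< firstLeaf T) (inorder t) → Heap (graft t T)
graft-heap ht leaf                   t< = node ht nil t< []
graft-heap ht (node vl vr l<x r<x _) t< =
  node (graft-heap ht vl t<) (heap-⌊⌋ vr) (graft-below vl t< l<x) (inorder-below vr r<x)

-- Tells inorder words apart after a move: one of them begins with the root `x`, the other with a
-- smaller letter.
max∷≢++ : ∀ {u v w : Word} {x} → All (_< x) u → u ≢ [] → x ∷ v ≢ u ++ w
max∷≢++ []        u≢[] _  = u≢[] refl
max∷≢++ (y<x ∷ _) _    eq = ℕₚ.<-irrefl (sym (∷-injectiveˡ eq)) y<x

inorder≢[] : ∀ {t} → t ≢ nil → inorder t ≢ []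
inorder≢[] {nil}        t≢ _ = t≢ refl
inorder≢[] {node l x r} _  eq with inorder l | eq
... | []    | ()
... | _ ∷ _ | ()

replace-below : ∀ {t t′ x} → post t′ ≡ post t → All (_< x) (inorder t) → All (_< x) (inorder t′)
replace-below {t} {t′} eq = All-resp-↭
  (↭-trans (↭-sym (post↭inorder t)) (↭-trans (↭-reflexive (sym eq)) (post↭inorder t′)))

alternative : ∀ {t} → Defective t → Heap t → ∃ λ t′ → Heap t′ × post t′ ≡ post t × inorder t′ ≢ inorder t
alternative (left {l} {x} {r} d) (node hl hr l<x r<x) with l′ , hl′ , eq , neq ← alternative d hl =
  node l′ x r , node hl′ hr (replace-below {l} {l′} eq l<x) r<x , cong (_++ post r ++ x ∷ []) eq ,
  neq ∘ ++-cancelʳ (x ∷ inorder r) (inorder l′) (inorder l)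
alternative (right {l} {x} {r} d) (node hl hr l<x r<x) with r′ , hr′ , eq , neq ← alternative d hr =
  node l x r′ , node hl hr′ l<x (replace-below {r} {r′} eq r<x) , cong (λ u → post l ++ u ++ x ∷ []) eq ,
  neq ∘ ∷-injectiveʳ ∘ ++-cancelˡ (inorder l) (x ∷ inorder r′) (x ∷ inorder r)
alternative (onlyˡ {l} {x} l≢nil) (node hl _ l<x _) =
  node nil x l , node nil hl [] l<x , refl , max∷≢++ l<x (inorder≢[] l≢nil)
alternative (onlyʳ {x} {r} r≢nil) (node _ hr _ r<x) =
  node r x nil , node hr nil r<x [] , refl , max∷≢++ r<x (inorder≢[] r≢nil) ∘ sym
alternative (ascent {l} {x} {r} vl vr lt) (node hl _ l<x r<x) =
  -- The left subtree is hung below the first leaf of its sibling, which exceeds its root and hence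
  -- all its labels.
  node nil x (graft ⌊ l ⌋ r) ,
  node nil (graft-heap hl vr (inorder-below vl lt)) [] (graft-below vr (inorder-below vl lt) (root-below r r<x)) ,
  trans (cong (_++ x ∷ []) (trans (post-graft ⌊ l ⌋ r) (cong (post ⌊ l ⌋ ++_) (sym (post-⌊⌋ r)))))
        (++-assoc (post ⌊ l ⌋) (post ⌊ r ⌋) (x ∷ [])) ,
  max∷≢++ l<x (inorder≢[] (⌊⌋≢nil l))

-- Descents of postorder words

twiceDescents : ℕ → Word → ℕ
twiceDescents p []      = 0
twiceDescents p (y ∷ w) = (if does (y ℕₚ.<? p) then 2 else 0) + twiceDescents y w

twiceDescents-> : ∀ {p y} w → y < p → twiceDescents p (y ∷ w) ≡ 2 + twiceDescents y w
twiceDescents-> {p} {y} w y<p = cong (λ b → (if b then 2 else 0) + twiceDescents y w) (dec-true (y ℕₚ.<? p) y<p)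

twiceDescents-≤ : ∀ {p y} w → p ≤ y → twiceDescents p (y ∷ w) ≡ twiceDescents y w
twiceDescents-≤ {p} {y} w p≤y =
  cong (λ b → (if b then 2 else 0) + twiceDescents y w) (dec-false (y ℕₚ.<? p) (ℕₚ.≤⇒≯ p≤y))

twiceDescents-∷ : ∀ p y w → twiceDescents p (y ∷ w) ≤ 2 + twiceDescents y w
twiceDescents-∷ p y w with does (y ℕₚ.<? p)
... | true  = ℕₚ.≤-refl
... | false = ℕₚ.m≤n+m (twiceDescents y w) 2

++-assoc₃ : ∀ (u v : List S) x w → (u ++ v ++ x ∷ []) ++ w ≡ u ++ v ++ x ∷ w
++-assoc₃ u v x w = trans (++-assoc u (v ++ x ∷ []) w) (cong (u ++_) (++-assoc v (x ∷ []) w))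

size : BinTree → ℕ
size nil          = 0
size (node l _ r) = suc (size l + size r)

-- The largest possible value of twiceDescents p (post t).
capacity : BinTree → ℕ
capacity nil            = 0
capacity t@(node _ _ _) = suc (size t)

-- The last letter of `p ∷ post t`, since a postorder word ends with the root.
lastOr : ℕ → BinTree → ℕ
lastOr p nil          = p
lastOr p (node _ x _) = x

inner-below : ∀ l y r {x} → All (_< x) (inorder (node l y r)) → y ≤ x
inner-below l y r t<x = ℕₚ.<⇒≤ (All.head (All.++⁻ʳ (inorder l) t<x))

-- The letter before `x` is the root of the child and smaller than `x`, so `x` brings no descent
-- while the capacity grows by one.
capacity-onlyˡ : ∀ p l {x} w → l ≢ nil → All (_< x) (inorder l) →
  capacity l + twiceDescents (lastOr p l) (x ∷ w) < capacity (node l x nil) + twiceDescents x w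
capacity-onlyˡ p nil w l≢nil _ = contradiction refl l≢nil
capacity-onlyˡ p l@(node a y b) {x} w _ l<x rewrite twiceDescents-≤ w (inner-below a y b l<x) =
  ℕₚ.≤-reflexive (lemma (size l) (twiceDescents x w))
  where
  lemma : ∀ m n → suc (suc m + n) ≡ suc (suc (m + 0)) + n
  lemma = ℕ-Solver.solve-∀

capacity-onlyʳ : ∀ p r {x} w → r ≢ nil → All (_< x) (inorder r) →
  capacity r + twiceDescents (lastOr p r) (x ∷ w) < capacity (node nil x r) + twiceDescents x w
capacity-onlyʳ p nil w r≢nil _ = contradiction refl r≢nil
capacity-onlyʳ p r@(node a y b) {x} w _ r<x rewrite twiceDescents-≤ w (inner-below a y b r<x) = ℕₚ.≤-refl

-- A leaf adds at most one descent, counted as 2. Below any child `x` adds none; two children use up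
-- the capacity exactly, and an only child leaves one unit over.
capacity-node : ∀ p l r {x} w → All (_< x) (inorder l) → All (_< x) (inorder r) →
  capacity l + (capacity r + twiceDescents (lastOr (lastOr p l) r) (x ∷ w)) ≤
  capacity (node l x r) + twiceDescents x w
capacity-node p nil nil {x} w _ _ = twiceDescents-∷ p x w
capacity-node p nil r@(node _ _ _) w _ r<x = ℕₚ.<⇒≤ (capacity-onlyʳ p r w (λ ()) r<x)
capacity-node p l@(node _ _ _) nil w l<x _ = ℕₚ.<⇒≤ (capacity-onlyˡ p l w (λ ()) l<x)
capacity-node p l@(node _ _ _) r@(node a y b) {x} w _ r<x rewrite twiceDescents-≤ w (inner-below a y b r<x) =
  ℕₚ.≤-reflexive (lemma (size l) (size r) (twiceDescents x w))
  where
  lemma : ∀ k m n → suc k + (suc m + n) ≡ suc (suc (k + m)) + n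
  lemma = ℕ-Solver.solve-∀

-- The context `p` and `w` is carried along because descents also occur where the words of subtrees
-- meet.
twiceDescents-heap : ∀ {t} p w → Heap t →
                     twiceDescents p (post t ++ w) ≤ capacity t + twiceDescents (lastOr p t) w
twiceDescents-heap p w nil = ℕₚ.≤-refl
twiceDescents-heap p w (node {l} {x} {r} hl hr l<x r<x) = begin
  twiceDescents p ((post l ++ post r ++ x ∷ []) ++ w)
    ≡⟨ cong (twiceDescents p) (++-assoc₃ (post l) (post r) x w) ⟩
  twiceDescents p (post l ++ post r ++ x ∷ w)
    ≤⟨ twiceDescents-heap p (post r ++ x ∷ w) hl ⟩
  capacity l + twiceDescents (lastOr p l) (post r ++ x ∷ w)
    ≤⟨ ℕₚ.+-monoʳ-≤ (capacity l) (twiceDescents-heap (lastOr p l) (x ∷ w) hr) ⟩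
  capacity l + (capacity r + twiceDescents (lastOr (lastOr p l) r) (x ∷ w))
    ≤⟨ capacity-node p l r w l<x r<x ⟩
  capacity (node l x r) + twiceDescents x w ∎
  where open ℕₚ.≤-Reasoning

sizeᶠ : FullTree → ℕ
sizeᶠ T = size ⌊ T ⌋

mutual
  -- The bound is attained: validity forces a descent from the root of each left subtree to the
  -- first leaf of its sibling.
  twiceDescents-valid : ∀ {T} p w → Valid T → firstLeaf T < p →
                        twiceDescents p (postorder T ++ w) ≡ suc (sizeᶠ T + twiceDescents (root T) w)
  twiceDescents-valid p w leaf x<p = twiceDescents-> w x<p
  twiceDescents-valid p w (node {l} {x} {r} vl vr l<x r<x lt) first<p = begin
    twiceDescents p ((postorder l ++ postorder r ++ x ∷ []) ++ w)
      ≡⟨ cong (twiceDescents p) (++-assoc₃ (postorder l) (postorder r) x w) ⟩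
    twiceDescents p (postorder l ++ postorder r ++ x ∷ w)
      ≡⟨ twiceDescents-valid p (postorder r ++ x ∷ w) vl first<p ⟩
    suc (sizeᶠ l + twiceDescents (root l) (postorder r ++ x ∷ w))
      ≡⟨ cong (λ d → suc (sizeᶠ l + d)) (twiceDescents-joined w vr r<x lt) ⟩
    suc (sizeᶠ l + suc (sizeᶠ r + twiceDescents x w))
      ≡⟨ lemma (sizeᶠ l) (sizeᶠ r) (twiceDescents x w) ⟩
    suc (suc (sizeᶠ l + sizeᶠ r) + twiceDescents x w) ∎
    where
    open ≡-Reasoning
    lemma : ∀ k m n → suc (k + suc (m + n)) ≡ suc (suc (k + m) + n)
    lemma = ℕ-Solver.solve-∀

  twiceDescents-joined : ∀ {p r x} w → Valid r → root r < x → firstLeaf r < p →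
                         twiceDescents p (postorder r ++ x ∷ w) ≡ suc (sizeᶠ r + twiceDescents x w)
  twiceDescents-joined {p} {r} {x} w vr r<x lt = trans (twiceDescents-valid p (x ∷ w) vr lt)
    (cong (λ d → suc (sizeᶠ r + d)) (twiceDescents-≤ w (ℕₚ.<⇒≤ r<x)))

-- Without the descent in front of the first leaf the count is smaller by 2; the `suc` on the left
-- avoids subtraction.
twiceDescents-valid-≤ : ∀ {T} p w → Valid T → p ≤ firstLeaf T →
                        suc (twiceDescents p (postorder T ++ w)) ≡ sizeᶠ T + twiceDescents (root T) w
twiceDescents-valid-≤ p w leaf p≤x = cong suc (twiceDescents-≤ w p≤x)
twiceDescents-valid-≤ p w (node {l} {x} {r} vl vr l<x r<x lt) p≤first = begin
  suc (twiceDescents p ((postorder l ++ postorder r ++ x ∷ []) ++ w))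
    ≡⟨ cong (suc ∘ twiceDescents p) (++-assoc₃ (postorder l) (postorder r) x w) ⟩
  suc (twiceDescents p (postorder l ++ postorder r ++ x ∷ w))
    ≡⟨ twiceDescents-valid-≤ p (postorder r ++ x ∷ w) vl p≤first ⟩
  sizeᶠ l + twiceDescents (root l) (postorder r ++ x ∷ w)
    ≡⟨ cong (sizeᶠ l +_) (twiceDescents-joined w vr r<x lt) ⟩
  sizeᶠ l + suc (sizeᶠ r + twiceDescents x w)
    ≡⟨ lemma (sizeᶠ l) (sizeᶠ r) (twiceDescents x w) ⟩
  suc (sizeᶠ l + sizeᶠ r) + twiceDescents x w ∎
  where
  open ≡-Reasoning
  lemma : ∀ k m n → k + suc (m + n) ≡ suc (k + m) + n
  lemma = ℕ-Solver.solve-∀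

-- A loss in a subtree persists, as all other estimates remain upper bounds. An only child wastes
-- one unit of capacity, and an ascent before the first leaf of `r` loses a whole descent.
twiceDescents-defective : ∀ {t} p w → Defective t → Heap t →
                          twiceDescents p (post t ++ w) < capacity t + twiceDescents (lastOr p t) w
twiceDescents-defective p w (left {l} {x} {r} d) (node hl hr l<x r<x) = begin-strict
  twiceDescents p ((post l ++ post r ++ x ∷ []) ++ w)
    ≡⟨ cong (twiceDescents p) (++-assoc₃ (post l) (post r) x w) ⟩
  twiceDescents p (post l ++ post r ++ x ∷ w)
    <⟨ twiceDescents-defective p (post r ++ x ∷ w) d hl ⟩
  capacity l + twiceDescents (lastOr p l) (post r ++ x ∷ w)
    ≤⟨ ℕₚ.+-monoʳ-≤ (capacity l) (twiceDescents-heap (lastOr p l) (x ∷ w) hr) ⟩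
  capacity l + (capacity r + twiceDescents (lastOr (lastOr p l) r) (x ∷ w))
    ≤⟨ capacity-node p l r w l<x r<x ⟩
  capacity (node l x r) + twiceDescents x w ∎
  where open ℕₚ.≤-Reasoning
twiceDescents-defective p w (right {l} {x} {r} d) (node hl hr l<x r<x) = begin-strict
  twiceDescents p ((post l ++ post r ++ x ∷ []) ++ w)
    ≡⟨ cong (twiceDescents p) (++-assoc₃ (post l) (post r) x w) ⟩
  twiceDescents p (post l ++ post r ++ x ∷ w)
    ≤⟨ twiceDescents-heap p (post r ++ x ∷ w) hl ⟩
  capacity l + twiceDescents (lastOr p l) (post r ++ x ∷ w)
    <⟨ ℕₚ.+-monoʳ-< (capacity l) (twiceDescents-defective (lastOr p l) (x ∷ w) d hr) ⟩
  capacity l + (capacity r + twiceDescents (lastOr (lastOr p l) r) (x ∷ w))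
    ≤⟨ capacity-node p l r w l<x r<x ⟩
  capacity (node l x r) + twiceDescents x w ∎
  where open ℕₚ.≤-Reasoning
twiceDescents-defective p w (onlyˡ {l} {x} l≢nil) (node hl _ l<x _) = begin-strict
  twiceDescents p ((post l ++ x ∷ []) ++ w)
    ≡⟨ cong (twiceDescents p) (++-assoc (post l) (x ∷ []) w) ⟩
  twiceDescents p (post l ++ x ∷ w)
    ≤⟨ twiceDescents-heap p (x ∷ w) hl ⟩
  capacity l + twiceDescents (lastOr p l) (x ∷ w)
    <⟨ capacity-onlyˡ p l w l≢nil l<x ⟩
  capacity (node l x nil) + twiceDescents x w ∎
  where open ℕₚ.≤-Reasoning
twiceDescents-defective p w (onlyʳ {x} {r} r≢nil) (node _ hr _ r<x) = begin-strict
  twiceDescents p ((post r ++ x ∷ []) ++ w)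
    ≡⟨ cong (twiceDescents p) (++-assoc (post r) (x ∷ []) w) ⟩
  twiceDescents p (post r ++ x ∷ w)
    ≤⟨ twiceDescents-heap p (x ∷ w) hr ⟩
  capacity r + twiceDescents (lastOr p r) (x ∷ w)
    <⟨ capacity-onlyʳ p r w r≢nil r<x ⟩
  capacity (node nil x r) + twiceDescents x w ∎
  where open ℕₚ.≤-Reasoning
twiceDescents-defective p w (ascent {l} {x} {r} vl vr lt) (node hl _ l<x r<x) = begin-strict
  twiceDescents p ((post ⌊ l ⌋ ++ post ⌊ r ⌋ ++ x ∷ []) ++ w)
    ≡⟨ cong (twiceDescents p) (++-assoc₃ (post ⌊ l ⌋) (post ⌊ r ⌋) x w) ⟩
  twiceDescents p (post ⌊ l ⌋ ++ post ⌊ r ⌋ ++ x ∷ w)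
    ≤⟨ twiceDescents-heap p (post ⌊ r ⌋ ++ x ∷ w) hl ⟩
  capacity ⌊ l ⌋ + twiceDescents (lastOr p ⌊ l ⌋) (post ⌊ r ⌋ ++ x ∷ w)
    ≡⟨ cong₂ _+_ (capacity-⌊⌋ l) (cong₂ (λ q u → twiceDescents q (u ++ x ∷ w)) (lastOr-⌊⌋ l) (post-⌊⌋ r)) ⟩
  suc (sizeᶠ l) + twiceDescents (root l) (postorder r ++ x ∷ w)
    ≡⟨ ℕₚ.+-suc (sizeᶠ l) _ ⟨
  sizeᶠ l + suc (twiceDescents (root l) (postorder r ++ x ∷ w))
    ≡⟨ cong (sizeᶠ l +_) (twiceDescents-valid-≤ (root l) (x ∷ w) vr (ℕₚ.<⇒≤ lt)) ⟩
  sizeᶠ l + (sizeᶠ r + twiceDescents (root r) (x ∷ w))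
    ≡⟨ cong (λ d → sizeᶠ l + (sizeᶠ r + d)) (twiceDescents-≤ w (ℕₚ.<⇒≤ (root-below r r<x))) ⟩
  sizeᶠ l + (sizeᶠ r + twiceDescents x w)
    ≡⟨ ℕₚ.+-assoc (sizeᶠ l) (sizeᶠ r) _ ⟨
  sizeᶠ l + sizeᶠ r + twiceDescents x w
    <⟨ ℕₚ.+-monoˡ-< (twiceDescents x w) (ℕₚ.m<n⇒m<1+n (ℕₚ.n<1+n _)) ⟩
  capacity (node ⌊ l ⌋ x ⌊ r ⌋) + twiceDescents x w ∎
  where
  open ℕₚ.≤-Reasoning
  capacity-⌊⌋ : ∀ T → capacity ⌊ T ⌋ ≡ suc (sizeᶠ T)
  capacity-⌊⌋ (leaf _)     = refl
  capacity-⌊⌋ (node _ _ _) = refl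
  lastOr-⌊⌋ : ∀ T → lastOr p ⌊ T ⌋ ≡ root T
  lastOr-⌊⌋ (leaf _)     = refl
  lastOr-⌊⌋ (node _ _ _) = refl

length-post : ∀ t → length (post t) ≡ size t
length-post nil          = refl
length-post (node l x r) = begin
  length (post l ++ post r ++ x ∷ [])                   ≡⟨ length-++ (post l) ⟩
  length (post l) + length (post r ++ x ∷ [])           ≡⟨ cong (length (post l) +_) (length-++ (post r)) ⟩
  length (post l) + (length (post r) + 1)               ≡⟨ cong₂ (λ a b → a + (b + 1)) (length-post l) (length-post r) ⟩
  size l + (size r + 1)                                 ≡⟨ lemma (size l) (size r) ⟩
  suc (size l + size r)                                 ∎
  where
  open ≡-Reasoning
  lemma : ∀ a b → a + (b + 1) ≡ suc (a + b)
  lemma = ℕ-Solver.solve-∀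

defective-post≢ : ∀ {t T} → Defective t → Heap t → Valid T → post t ≢ postorder T
defective-post≢ {nil}            () _ _ _
defective-post≢ {t@(node _ _ _)} {T} d h v eq = ℕₚ.<-irrefl capacity≡ (begin-strict
  twiceDescents p (postorder T ++ [])  ≡⟨ cong (λ u → twiceDescents p (u ++ [])) eq ⟨
  twiceDescents p (post t ++ [])       <⟨ twiceDescents-defective p [] d h ⟩
  capacity t + 0                       ∎)
  where
  open ℕₚ.≤-Reasoning
  -- Larger than the first letter of the word, so that this letter counts as a descent and the valid
  -- tree reaches its capacity.
  p = suc (firstLeaf T)
  sizes : sizeᶠ T ≡ size t
  sizes = trans (sym (length-post ⌊ T ⌋)) (trans (cong length (trans (post-⌊⌋ T) (sym eq))) (length-post t))
  capacity≡ : twiceDescents p (postorder T ++ []) ≡ capacity t + 0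
  capacity≡ = trans (twiceDescents-valid p [] v ℕₚ.≤-refl) (cong (λ n → suc (n + 0)) sizes)

-- Rebuilding a valid tree from its postorder word

reduce : ℕ → List FullTree → List FullTree
reduce y (r ∷ l ∷ st) = node l y r ∷ st
-- A default value: `decode-postorder` reduces only when two trees are on the stack.
reduce y st           = st

-- In the postorder word of a valid tree, the leaves are the first letter and
-- the descent bottoms, so the tree can be rebuilt as from reverse Polish notation.
decode : ℕ → List FullTree → Word → List FullTree
decode p st []      = st
decode p st (y ∷ w) = if does (y ℕₚ.<? p) then decode y (leaf y ∷ st) w else decode y (reduce y st) w

decode-postorder : ∀ {T} p st w → Valid T → firstLeaf T < p →
                   decode p st (postorder T ++ w) ≡ decode (root T) (T ∷ st) w
decode-postorder {leaf x} p st w leaf x<p =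
  cong (λ b → if b then decode x (leaf x ∷ st) w else decode x (reduce x st) w) (dec-true (x ℕₚ.<? p) x<p)
decode-postorder {node l x r} p st w (node vl vr l<x r<x lt) first<p = begin
  decode p st ((postorder l ++ postorder r ++ x ∷ []) ++ w)
    ≡⟨ cong (decode p st) (++-assoc₃ (postorder l) (postorder r) x w) ⟩
  decode p st (postorder l ++ postorder r ++ x ∷ w)
    ≡⟨ decode-postorder p st (postorder r ++ x ∷ w) vl first<p ⟩
  decode (root l) (l ∷ st) (postorder r ++ x ∷ w)
    ≡⟨ decode-postorder (root l) (l ∷ st) (x ∷ w) vr lt ⟩
  decode (root r) (r ∷ l ∷ st) (x ∷ w)
    ≡⟨ cong (λ b → if b then decode x (leaf x ∷ r ∷ l ∷ st) w else decode x (node l x r ∷ st) w)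
         (dec-false (x ℕₚ.<? root r) (ℕₚ.<-asym r<x)) ⟩
  decode x (node l x r ∷ st) w ∎
  where open ≡-Reasoning

postorder-injective : ∀ {T U} → Valid T → Valid U → postorder T ≡ postorder U → T ≡ U
postorder-injective {T} {U} vT vU eq = ∷-injectiveˡ (begin
  T ∷ []                            ≡⟨ decode-postorder p [] [] vT (s≤s (ℕₚ.m≤m⊔n (firstLeaf T) (firstLeaf U))) ⟨
  decode p [] (postorder T ++ [])   ≡⟨ cong (λ w → decode p [] (w ++ [])) eq ⟩
  decode p [] (postorder U ++ [])   ≡⟨ decode-postorder p [] [] vU (s≤s (ℕₚ.m≤n⊔m (firstLeaf T) (firstLeaf U))) ⟩
  U ∷ []                            ∎)
  where
  open ≡-Reasoning
  -- A common starting letter above both first leaves, so that one and the same decoding applies to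
  -- both words.
  p = suc (firstLeaf T ⊔ firstLeaf U)

-- Uniquely sorted permutations

map-unique : ∀ {f : S → T} {xs} → (∀ {x y} → x ∈ xs → y ∈ xs → f x ≡ f y → x ≡ y) → Unique xs → Unique (map f xs)
map-unique         inj []         = []
map-unique {f = f} inj (x∉ ∷ uxs) =
  All.map⁺ (All.tabulate λ y∈ eq → All.lookup x∉ y∈ (inj (here refl) (there y∈) eq)) ∷
  map-unique (λ x∈ y∈ → inj (there x∈) (there y∈)) uxs

labels : ℕ → List ℕ
labels n = map suc (downFrom n)

labels-decreasing : ∀ n → Decreasing (labels n)
labels-decreasing n = AllPairs.map⁺ (AllPairs.applyDownFrom⁺₁ _ n λ i<j _ → s≤s i<j)

labels↭ : ∀ n → labels n ↭ map suc (upTo n)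
labels↭ n = map⁺ suc (↭-trans (↭-sym (↭-reverse (downFrom n))) (↭-reflexive (reverse-downFrom n)))

length-labels : ∀ n → length (labels n) ≡ n
length-labels n = trans (length-map suc (downFrom n)) (length-downFrom n)

∈S-unique : ∀ {n σ} → σ ∈S n → Unique σ
∈S-unique {n} σ∈S = Permutationₛ.Unique-resp-↭ (setoid ℕ)
  (↭⇒↭ₛ (↭-sym σ∈S)) (Unique.map⁺ ℕₚ.suc-injective (Unique.upTo⁺ n))

preimage : ∀ {n π σ} → σ ∈S n → s σ ≡ π → ∃ λ t → Heap t × Unique (inorder t) × inorder t ≡ σ × post t ≡ π
preimage σ∈S sσ≡π with t , ht , refl ← heap-of (∈S-unique σ∈S) =
  t , ht , ∈S-unique σ∈S , refl , trans (sym (s-inorder ht)) sσ≡π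

-- A preimage is the inorder word of a decreasing tree with this postorder word. Such a tree is not
-- defective by the count of descents, and a valid one is `T` by decoding.
postorder-uniquelySorted : ∀ {n T} → Valid T → postorder T ∈S n → UniquelySorted n (postorder T)
postorder-uniquelySorted {n} {T} v T∈S =
  T∈S , inorder ⌊ T ⌋ ∷ [] , [] ∷ [] , (λ σ → mk⇔ sorts unique) , refl
  where
  sorts : ∀ {σ} → σ ∈ inorder ⌊ T ⌋ ∷ [] → σ ∈S n × s σ ≡ postorder T
  sorts (here refl) = ↭-trans (↭-sym (postorder↭inorder T)) T∈S , trans (s-inorder (heap-⌊⌋ v)) (post-⌊⌋ T)
  unique : ∀ {σ} → σ ∈S n × s σ ≡ postorder T → σ ∈ inorder ⌊ T ⌋ ∷ []
  unique (σ∈S , sσ≡) with t , ht , ut , refl , eq ← preimage σ∈S sσ≡ with classify ht ut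
  ... | inj₁ refl with () ← subst (root T ∈_) (sym eq) (root∈postorder T)
  ... | inj₂ (inj₁ (U , vU , refl)) =
    here (cong (inorder ∘ ⌊_⌋) (postorder-injective vU v (trans (sym (post-⌊⌋ U)) eq)))
  ... | inj₂ (inj₂ d) = contradiction eq (defective-post≢ d ht v)

-- If the tree of the only preimage were defective, `alternative` would supply a second preimage.
-- Positive length excludes the empty word, which is uniquely sorted but comes from no full tree.
uniquelySorted-postorder : ∀ {n π} → UniquelySorted (suc n) π → ∃ λ T → Valid T × π ≡ postorder T
uniquelySorted-postorder {n} (π∈S , σ ∷ [] , _ , fibre , refl)
  with σ∈S , sσ≡ ← Equivalence.to (fibre σ) (here refl)
  with t , ht , ut , refl , refl ← preimage σ∈S sσ≡
  with classify ht ut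
... | inj₁ refl = contradiction σ∈S (¬[]∈S)
  where
  ¬[]∈S : ¬ ([] ∈S suc n)
  ¬[]∈S p with () ← ∈-resp-↭ (↭-sym p) (here refl)
... | inj₂ (inj₁ (T , v , refl)) = T , v , post-⌊⌋ T
... | inj₂ (inj₂ d) with t′ , ht′ , eq , neq ← alternative d ht
  with Equivalence.from (fibre (inorder t′))
         (↭-trans (↭-sym (post↭inorder t′)) (↭-trans (↭-reflexive eq) π∈S) , trans (s-inorder ht′) eq)
...   | here same = contradiction same neq

uniquelySorted-cardinality : ∀ n → HasCardinality (UniquelySorted (suc n)) (length (trees (labels (suc n))))
uniquelySorted-cardinality n =
  map postorder (trees X) , map-unique injective (treesWithin-unique (length X) decX) ,
  (λ π → mk⇔ to from) , length-map postorder (trees X)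
  where
  X = labels (suc n)
  decX = labels-decreasing (suc n)
  injective : ∀ {T U} → T ∈ trees X → U ∈ trees X → postorder T ≡ postorder U → T ≡ U
  injective T∈ U∈ = postorder-injective (proj₁ (trees-sound decX T∈)) (proj₁ (trees-sound decX U∈))
  to : ∀ {π} → π ∈ map postorder (trees X) → UniquelySorted (suc n) π
  to π∈ with T , T∈ , refl ← ∈-map⁻ postorder π∈ with v , T↭X ← trees-sound decX T∈ =
    postorder-uniquelySorted v (↭-trans T↭X (labels↭ (suc n)))
  from : ∀ {π} → UniquelySorted (suc n) π → π ∈ map postorder (trees X)
  from u@(π∈S , _) with T , v , refl ← uniquelySorted-postorder u =
    ∈-map⁺ postorder (treesWithin-complete (length X) decX ℕₚ.≤-refl v (↭-trans π∈S (↭-sym (labels↭ (suc n)))))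

open import Data.Integer.Base using (+_)

mainTheorem1 : (k : ℕ) → ∃ λ N → HasCardinality (UniquelySorted (2 * k + 1)) N × + N ≡ lassalle (k + 1)
mainTheorem1 k rewrite ℕₚ.+-comm (2 * k) 1 | ℕₚ.+-comm k 1 =
  length (trees (labels n)) , uniquelySorted-cardinality (2 * k) , (begin
    + length (trees (labels n))  ≡⟨ length-trees (labels-decreasing n) ⟩
    ω (length (labels n))        ≡⟨ cong ω (length-labels n) ⟩
    ω n                          ≡⟨ ω-odd k ⟩
    lassalle (suc k)             ∎)
  where
  open ≡-Reasoning
  n = suc (2 * k)
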